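{- Let $T$ be a tree of order $n\ge 1$. Then $d(T)\le f(n)$, where $$f(n)=\begin{cases}2^{n-1}+(n+3)\cdot 2^{\frac{n-5}{2}}, & n \text{ odd},\\ 2^{n-1}+(n+6)\cdot 2^{\frac{n-6}{2}}, & n\text{ even}.\end{cases}$$ Equality holds if and only if $T\cong F_n$, where: - $F_n=K_1\ast \tfrac{n-1}{2}K_2$ if $n$ is odd; - $F_n\in\{P_6,\ K_2\ast 2K_2\}$ if $n=6$; - $F_n=K_2\ast\tfrac{n-2}{2}K_2$ if $n$ is even and $n\ne 6$.
   Context: All graphs are finite, simple and undirected. A subset $D\subseteq V(G)$ is a dissociation set of $G$ if the induced subgraph $G[D]$ has maximum degree at most $1$; the empty set is a dissociation set. $d(G)$ denotes the total number of dissociation sets of $G$, including the empty set. Notation $K_r\ast H$: let $H$ be a graph all of whose components are complete graphs, and let $K_r$ be a complete graph disjoint from $H$. Then $K_r\ast H$ is the connected graph obtained by choosing one vertex $u$ of $K_r$ and joining $u$ by an edge to exactly one vertex of each component of $H$. Here $mK_2$ denotes $m$ disjoint edges. Thus: - $K_1\ast mK_2$ is a vertex adjacent to one endpoint of each of $m$ disjoint edges; - $K_2\ast mK_2$ is an edge $uw$ with $u$ adjacent to one endpoint of each of $m$ disjoint edges. $P_6$ is the path on $6$ vertices. -}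

module Defs where

open import Data.Bool.Base using (if_then_else_)
open import Data.Fin.Base using (Fin; zero; suc; toℕ; fromℕ; inject₁)
import Data.Fin.Properties as Fin
open import Data.Fin.Subset using (Subset; inside; outside; _∈_; _∩_; ∣_∣)
open import Data.Fin.Subset.Properties using (_∈?_)
open import Data.Integer.Base as ℤ using (ℤ; +_; -[1+_])
open import Data.List.Base using (List; []; _∷_; _++_; map; filter; length)
open import Data.Nat.Base as ℕ using (ℕ; suc; _∸_; _≤_)
open import Data.Nat.Divisibility using (_∣_; _∣?_)
import Data.Nat.Properties as ℕ
open import Data.Product.Base using (_×_; _,_; proj₂)
open import Data.Rational.Base as ℚ using (ℚ)
open import Data.Sum.Base using (_⊎_; inj₁; inj₂; swap)
open import Data.Vec.Base using ([]; _∷_; tabulate)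
open import Function.Bundles using (_↔_; _⇔_; Inverse)
open import Function.Definitions using (Injective)
open import Relation.Binary.Construct.Closure.ReflexiveTransitive using (Star)
open import Relation.Binary.Definitions using (Decidable; DecidableEquality; Symmetric)
open import Relation.Binary.PropositionalEquality using (_≡_; _≢_; refl; sym)
open import Relation.Nullary.Decidable using (does; ¬?; _×-dec_; _⊎-dec_; _→-dec_)
open import Relation.Nullary.Negation using (¬_)
import Relation.Unary as U

record Graph (V : Set) : Set₁ where
  infix 4 _~_ _~?_
  field
    _~_     : V → V → Set
    _~?_    : Decidable _~_
    ~-sym   : Symmetric _~_
    ~-irrefl : ∀ {v} → ¬ (v ~ v)

infix 4 _≅_

record _≅_ {V W : Set} (G : Graph V) (H : Graph W) : Set where
  private
    module G = Graph G
    module H = Graph H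
  field
    bijection : V ↔ W
  open Inverse bijection public using (to; from)
  field
    preserves : ∀ v w → (v G.~ w) ⇔ (to v H.~ to w)

Connected : {V : Set} → Graph V → Set
Connected {V} G = ∀ (v w : V) → Star (Graph._~_ G) v w

-- A cycle of length k + 3: distinct vertices c 0, …, c (k + 2), cyclically adjacent.
record Cycle {V : Set} (G : Graph V) : Set where
  open Graph G
  field
    k        : ℕ
    c        : Fin (3 ℕ.+ k) → V
    distinct : Injective _≡_ _≡_ c
    step     : ∀ (i : Fin (2 ℕ.+ k)) → c (inject₁ i) ~ c (suc i)
    close    : c (fromℕ (2 ℕ.+ k)) ~ c zero

record IsTree {V : Set} (G : Graph V) : Set where
  field
    connected : Connected G
    acyclic   : ¬ Cycle G

module _ {n : ℕ} (G : Graph (Fin n)) where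
  open Graph G

  neighbours : Fin n → Subset n
  neighbours v = tabulate (λ w → does (v ~? w))

  -- For v ∈ D, the degree of v in the induced subgraph G[D] is ∣ neighbours v ∩ D ∣.
  IsDissociation : Subset n → Set
  IsDissociation D = ∀ v → v ∈ D → ∣ neighbours v ∩ D ∣ ≤ 1

  isDissociation? : U.Decidable IsDissociation
  isDissociation? D = Fin.all? λ v → (v ∈? D) →-dec (∣ neighbours v ∩ D ∣ ℕ.≤? 1)

-- Each subset of Fin n occurs exactly once.
subsets : ∀ n → List (Subset n)
subsets ℕ.zero  = [] ∷ []
subsets (suc n) = map (outside ∷_) (subsets n) ++ map (inside ∷_) (subsets n)

d : ∀ {n} → Graph (Fin n) → ℕ
d {n} G = length (filter (isDissociation? G) (subsets n))

complete : ∀ r → Graph (Fin r)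
complete r = record
  { _~_      = _≢_
  ; _~?_     = λ i j → ¬? (i Fin.≟ j)
  ; ~-sym    = λ i≢j j≡i → i≢j (sym j≡i)
  ; ~-irrefl = λ i≢i → i≢i refl
  }

path : ∀ n → Graph (Fin n)
path n = record
  { _~_      = λ i j → suc (toℕ i) ≡ toℕ j ⊎ suc (toℕ j) ≡ toℕ i
  ; _~?_     = λ i j → (suc (toℕ i) ℕ.≟ toℕ j) ⊎-dec (suc (toℕ j) ℕ.≟ toℕ i)
  ; ~-sym    = swap
  ; ~-irrefl = λ { (inj₁ p) → ℕ.1+n≢n p ; (inj₂ p) → ℕ.1+n≢n p }
  }

infix 8 _copiesOf_

_copiesOf_ : ∀ m {V : Set} → Graph V → Graph (Fin m × V)
m copiesOf G = record
  { _~_      = λ { (i , v) (j , w) → i ≡ j × v ~ w }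
  ; _~?_     = λ { (i , v) (j , w) → (i Fin.≟ j) ×-dec (v ~? w) }
  ; ~-sym    = λ { (i≡j , v~w) → sym i≡j , ~-sym v~w }
  ; ~-irrefl = λ { (_ , v~v) → ~-irrefl v~v }
  }
  where open Graph G

-- The disjoint union of G and H together with all edges between the vertex u of G
-- and the vertices of H satisfying R.
module Attach {V W : Set} (_≟_ : DecidableEquality V)
              (G : Graph V) (u : V)
              (H : Graph W) {R : W → Set} (R? : U.Decidable R) where
  private
    module G = Graph G
    module H = Graph H

  Adj : V ⊎ W → V ⊎ W → Set
  Adj (inj₁ x) (inj₁ y) = x G.~ y
  Adj (inj₁ x) (inj₂ w) = x ≡ u × R w
  Adj (inj₂ w) (inj₁ x) = x ≡ u × R w
  Adj (inj₂ w) (inj₂ z) = w H.~ z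

  adj? : Decidable Adj
  adj? (inj₁ x) (inj₁ y) = x G.~? y
  adj? (inj₁ x) (inj₂ w) = (x ≟ u) ×-dec R? w
  adj? (inj₂ w) (inj₁ x) = (x ≟ u) ×-dec R? w
  adj? (inj₂ w) (inj₂ z) = w H.~? z

  adj-sym : Symmetric Adj
  adj-sym {inj₁ _} {inj₁ _} p = G.~-sym p
  adj-sym {inj₁ _} {inj₂ _} p = p
  adj-sym {inj₂ _} {inj₁ _} p = p
  adj-sym {inj₂ _} {inj₂ _} p = H.~-sym p

  adj-irrefl : ∀ {x} → ¬ Adj x x
  adj-irrefl {inj₁ _} = G.~-irrefl
  adj-irrefl {inj₂ _} = H.~-irrefl

  attach : Graph (V ⊎ W)
  attach = record
    { _~_ = Adj ; _~?_ = adj? ; ~-sym = λ {x} {y} → adj-sym {x} {y}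
    ; ~-irrefl = λ {x} → adj-irrefl {x} }

-- K_(r+1) ∗ mK₂: the distinguished vertex of K_(r+1) is zero, and it is joined to
-- the endpoint zero of each of the m disjoint edges.
K[1+_]∗_K₂ : ∀ r m → Graph (Fin (suc r) ⊎ (Fin m × Fin 2))
K[1+ r ]∗ m K₂ =
  Attach.attach Fin._≟_ (complete (suc r)) zero
                (m copiesOf complete 2) {R = λ e → proj₂ e ≡ zero} (λ e → proj₂ e Fin.≟ zero)

K₁∗_K₂ : ∀ m → Graph (Fin 1 ⊎ (Fin m × Fin 2))
K₁∗ m K₂ = K[1+ 0 ]∗ m K₂

K₂∗_K₂ : ∀ m → Graph (Fin 2 ⊎ (Fin m × Fin 2))
K₂∗ m K₂ = K[1+ 1 ]∗ m K₂

toℚ : ℕ → ℚ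
toℚ n = (+ n) ℚ./ 1

infix 9 2^_

2^_ : ℤ → ℚ
2^ (+ k)    = toℚ (2 ℕ.^ k)
2^ -[1+ k ] = ℚ._/_ (+ 1) (2 ℕ.^ suc k) {{ℕ.m^n≢0 2 (suc k)}}

-- The exponents (n - 5)/2 and (n - 6)/2 are negative for small n, hence integer
-- powers in ℚ; both integer divisions by 2 are exact in the case where they are used.
f : ℕ → ℚ
f n = if does (2 ∣? n)
      then 2^ (+ n ℤ.- + 1) ℚ.+ toℚ (n ℕ.+ 6) ℚ.* 2^ ((+ n ℤ.- + 6) ℤ./ℕ 2)
      else 2^ (+ n ℤ.- + 1) ℚ.+ toℚ (n ℕ.+ 3) ℚ.* 2^ ((+ n ℤ.- + 5) ℤ./ℕ 2)

-- T ≅F n means that T is isomorphic to F_n (for n = 6, to one of the two graphs F_6).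
infix 4 _≅F_

data _≅F_ {V : Set} (T : Graph V) (n : ℕ) : Set where
  odd       : ¬ (2 ∣ n) → T ≅ K₁∗ ((n ∸ 1) ℕ./ 2) K₂ → T ≅F n
  six-path  : n ≡ 6 → T ≅ path 6 → T ≅F n
  six-star  : n ≡ 6 → T ≅ K₂∗ 2 K₂ → T ≅F n
  even      : 2 ∣ n → n ≢ 6 → T ≅ K₂∗ ((n ∸ 2) ℕ./ 2) K₂ → T ≅F n

{-# OPTIONS --safe #-}

-- Every tree arises from single vertices by joining the roots of two rooted trees, and
-- counting dissociation sets by the status of the root gives a recursion for d. A tree with
-- at least three vertices has a pendant path P₂ attached to a vertex of a smaller tree, or has
-- two leaves with a common neighbour; both reductions express d through d of a smaller tree
-- and through δ = 2α + β of a smaller tree rooted at the vertex v of attachment, where α and β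
-- count the dissociation sets avoiding v and those containing v but none of its neighbours.
-- Here δ ≤ 2^(k+1) + 2^⌊k/2⌋ for k edges: if all branches at v have at most two vertices this
-- is a direct count, and a larger branch, by induction, makes α too small. Equality forces the
-- branches at v to be copies of K₂ and at most one K₁, hence the tree to be F_n, up to one
-- exception on four vertices, which produces P₆.

module Submission where

open import Defs

-- With k edges, a dissociation set of prescribed root status is fixed by its trace on the other k
-- vertices, so α and β + γ are both at most 2^k. At the centre of a spider α = 2^k, β = `h k` and β
-- + γ = `ε k`; thus `bound k` splits into the sets avoiding the centre and the sets containing it.
-- A branch with q edges multiplies α by its σ. For `leaf` and `P₂` this factor is the full 2·2^q;
-- for q = 2 + j it is at most 7·2^j out of 8·2^j. This loss of one eighth in α has to pay for
-- whatever β may exceed `h`. The obstacle is that the vertex of attachment is arbitrary: σ of the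
-- smaller tree says nothing about its weights at that vertex. Hence δ is bounded for every root,
-- using the bound on σ for strictly smaller trees only. The account balances exactly at one place
-- outside the spiders: a single-vertex root over a branch with two edges, where 2·7 + 4 = 18 = 2·2³
-- + `h 3`. Of the two rooted trees of this form only `P₄` rooted at an end also has maximal σ, and
-- a pendant `P₂` at that end gives `P₆`.

-- Root-status weights of rooted trees, and estimates by powers of two.

module Weights where

  open import Data.Nat.Base using (ℕ; suc; _+_; _*_; _^_; _≤_; _<_; z≤n; s≤s; z<s)
  open import Data.Nat.Properties
  open import Data.Nat.Tactic.RingSolver using (solve-∀)
  open import Data.Product.Base using (_×_; _,_)
  open import Relation.Binary.PropositionalEquality using (_≡_; sym; trans; cong)
  open import Relation.Nullary.Negation using (contradiction)
  open import Data.Sum.Base using (inj₁; inj₂)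

  -- The upper bounds are added term by term; splitting an equality of sums into its terms carries
  -- the equality case back to the summands.
  +-mono-≤-tight : ∀ {x x′ y y′} → x ≤ x′ → y ≤ y′ → x + y ≡ x′ + y′ → x ≡ x′ × y ≡ y′
  +-mono-≤-tight {x} {x′} {y} {y′} x≤x′ y≤y′ eq
    with m≤n⇒m<n∨m≡n x≤x′ | m≤n⇒m<n∨m≡n y≤y′
  ... | inj₂ x≡x′ | inj₂ y≡y′ = x≡x′ , y≡y′
  ... | inj₁ x<x′ | _ = contradiction eq (<⇒≢ (+-mono-<-≤ x<x′ y≤y′))
  ... | inj₂ _ | inj₁ y<y′ = contradiction eq (<⇒≢ (+-mono-≤-< x≤x′ y<y′))

  -- Rooted trees: `join t s` adds an edge between the two roots and keeps the root of `t`, so the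
  -- right arguments along the left spine are the branches at the root. The root of `P₃` is an end
  -- of the path.
  data Tree : Set where
    leaf : Tree
    join : Tree → Tree → Tree

  pattern P₂ = join leaf leaf
  pattern P₃ = join leaf P₂

  edges : Tree → ℕ
  edges leaf       = 0
  edges (join t s) = suc (edges t + edges s)

  -- Dissociation sets D by the status of the root: not in D (α), in D and isolated
  -- in G[D] (β), in D with one neighbour in D (γ); σ counts all of them.
  α β γ σ : Tree → ℕ
  σ t = α t + (β t + γ t)
  α leaf       = 1
  α (join t s) = α t * σ s
  β leaf       = 1
  β (join t s) = β t * α s
  γ leaf       = 0
  γ (join t s) = γ t * α s + β t * β s

  -- h k = 2^⌊k/2⌋, and bound k is the maximum of d over the trees with k edges;
  -- the recursion of ε matches the effect on d of attaching P₂ to the centre of a spider.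
  h ε : ℕ → ℕ
  h 0             = 1
  h 1             = 1
  h (suc (suc k)) = 2 * h k
  ε 0             = 1
  ε 1             = 2
  ε (suc (suc k)) = 2 * ε k + h k

  bound : ℕ → ℕ
  bound k = 2 ^ k + ε k

  h≤h-suc : ∀ k → h k ≤ h (suc k)
  h≤h-suc 0 = ≤-refl
  h≤h-suc 1 = s≤s z≤n
  h≤h-suc (suc (suc k)) = *-monoʳ-≤ 2 (h≤h-suc k)

  h-suc≤2h : ∀ k → h (suc k) ≤ 2 * h k
  h-suc≤2h 0 = s≤s z≤n
  h-suc≤2h 1 = ≤-refl
  h-suc≤2h (suc (suc k)) = *-monoʳ-≤ 2 (h-suc≤2h k)

  h≤2^ : ∀ k → h k ≤ 2 ^ k
  h≤2^ 0 = ≤-refl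
  h≤2^ 1 = s≤s z≤n
  h≤2^ (suc (suc k)) = *-monoʳ-≤ 2 (≤-trans (h≤2^ k) (m≤n*m (2 ^ k) 2))

  0<h : ∀ k → 0 < h k
  0<h 0 = z<s
  0<h 1 = z<s
  0<h (suc (suc k)) = *-monoʳ-< 2 (0<h k)

  -- Strictness from index 1 on excludes twin leaves from the extremal trees; the tie
  -- `ε 1 ≡ 2 * ε 0` leaves only the path on three vertices.
  ε-suc<2ε : ∀ k → ε (suc (suc k)) < 2 * ε (suc k)
  ε-suc<2ε 0 = ≤-refl
  ε-suc<2ε 1 = ≤-refl
  ε-suc<2ε (suc (suc k)) = begin-strict
    2 * ε (suc (suc k)) + h (suc (suc k))   <⟨ +-mono-<-≤ (*-monoʳ-< 2 (ε-suc<2ε k)) (h-suc≤2h (suc k)) ⟩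
    2 * (2 * ε (suc k)) + 2 * h (suc k)     ≡⟨ *-distribˡ-+ 2 (2 * ε (suc k)) (h (suc k)) ⟨
    2 * (2 * ε (suc k) + h (suc k))         ∎
    where open ≤-Reasoning

  ε-suc≤2ε : ∀ k → ε (suc k) ≤ 2 * ε k
  ε-suc≤2ε 0       = ≤-refl
  ε-suc≤2ε (suc k) = <⇒≤ (ε-suc<2ε k)

  -- For q = 2 + j edges this puts `bound q` at most at 7·2^j, one eighth below 2·2^q. The constant
  -- is `ε 2`.
  ε≤3·2^ : ∀ j → ε (2 + j) ≤ 3 * 2 ^ j
  ε≤3·2^ 0 = ≤-refl
  ε≤3·2^ 1 = n≤1+n 5
  ε≤3·2^ (suc (suc j)) = begin
    2 * ε (2 + j) + 2 * h j          ≤⟨ +-mono-≤ (*-monoʳ-≤ 2 (ε≤3·2^ j)) (*-monoʳ-≤ 2 (h≤2^ j)) ⟩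
    2 * (3 * 2 ^ j) + 2 * 2 ^ j      ≤⟨ m≤m+n _ (4 * 2 ^ j) ⟩
    2 * (3 * 2 ^ j) + 2 * 2 ^ j + 4 * 2 ^ j  ≡⟨ ring (2 ^ j) ⟩
    3 * (2 * (2 * 2 ^ j))            ∎
    where
    open ≤-Reasoning
    ring : ∀ x → 2 * (3 * x) + 2 * x + 4 * x ≡ 3 * (2 * (2 * x))
    ring = solve-∀

  -- In terms of q = 4 + j: 2·`ε q` ≤ 2^q, which is what a root with a single branch of q edges
  -- requires. It fails for q = 2 and q = 3.
  ε≤8·2^ : ∀ j → ε (4 + j) ≤ 8 * 2 ^ j
  ε≤8·2^ 0 = ≤-refl
  ε≤8·2^ 1 = m≤m+n 12 4
  ε≤8·2^ (suc (suc j)) = begin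
    2 * ε (4 + j) + h (4 + j)        ≤⟨ +-mono-≤ (*-monoʳ-≤ 2 (ε≤8·2^ j)) (*-monoʳ-≤ 2 (*-monoʳ-≤ 2 (h≤2^ j))) ⟩
    2 * (8 * 2 ^ j) + 2 * (2 * 2 ^ j)      ≤⟨ m≤m+n _ (12 * 2 ^ j) ⟩
    2 * (8 * 2 ^ j) + 2 * (2 * 2 ^ j) + 12 * 2 ^ j  ≡⟨ ring (2 ^ j) ⟩
    8 * (2 * (2 * 2 ^ j))            ∎
    where
    open ≤-Reasoning
    ring : ∀ x → 2 * (8 * x) + 2 * (2 * x) + 12 * x ≡ 8 * (2 * (2 * x))
    ring = solve-∀

  -- Once the root is known to lie outside or inside the set, only a subset of the other `edges t`
  -- vertices remains to be chosen.
  α≤2^ : ∀ t → α t ≤ 2 ^ edges t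
  β+γ≤2^ : ∀ t → β t + γ t ≤ 2 ^ edges t

  2^-join : ∀ p q → 2 ^ p * (2 ^ q + 2 ^ q) ≡ 2 ^ suc (p + q)
  2^-join p q = trans (ring (2 ^ p) (2 ^ q)) (cong (2 *_) (sym (^-distribˡ-+-* 2 p q)))
    where
    ring : ∀ x y → x * (y + y) ≡ 2 * (x * y)
    ring = solve-∀

  α≤2^ leaf = ≤-refl
  α≤2^ (join t s) = begin
    α t * σ s                        ≤⟨ *-mono-≤ (α≤2^ t) (+-mono-≤ (α≤2^ s) (β+γ≤2^ s)) ⟩
    2 ^ edges t * (2 ^ edges s + 2 ^ edges s)  ≡⟨ 2^-join (edges t) (edges s) ⟩
    2 ^ edges (join t s)             ∎
    where open ≤-Reasoning

  β+γ≤2^ leaf = ≤-refl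
  β+γ≤2^ (join t s) = begin
    β t * α s + (γ t * α s + β t * β s)   ≡⟨ ring (β t) (γ t) (α s) (β s) ⟩
    (β t + γ t) * α s + β t * β s         ≤⟨ +-monoʳ-≤ ((β t + γ t) * α s) (*-monoˡ-≤ (β s) (m≤m+n (β t) (γ t))) ⟩
    (β t + γ t) * α s + (β t + γ t) * β s ≡⟨ *-distribˡ-+ (β t + γ t) (α s) (β s) ⟨
    (β t + γ t) * (α s + β s)             ≤⟨ *-mono-≤ (β+γ≤2^ t) (+-mono-≤ (α≤2^ s) (≤-trans (m≤m+n (β s) (γ s)) (β+γ≤2^ s))) ⟩
    2 ^ edges t * (2 ^ edges s + 2 ^ edges s)  ≡⟨ 2^-join (edges t) (edges s) ⟩
    2 ^ edges (join t s)                  ∎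
    where
    open ≤-Reasoning
    ring : ∀ b c a′ b′ → b * a′ + (c * a′ + b * b′) ≡ (b + c) * a′ + b * b′
    ring = solve-∀

  β≤2^ : ∀ t → β t ≤ 2 ^ edges t
  β≤2^ t = ≤-trans (m≤m+n (β t) (γ t)) (β+γ≤2^ t)

  -- An isolated root excludes its neighbours, and one excluded vertex already gains a factor of two
  -- over `β≤2^`.
  2β-join≤2^ : ∀ t s → 2 * β (join t s) ≤ 2 ^ edges (join t s)
  2β-join≤2^ t s = begin
    2 * (β t * α s)                ≤⟨ *-monoʳ-≤ 2 (*-mono-≤ (β≤2^ t) (α≤2^ s)) ⟩
    2 * (2 ^ edges t * 2 ^ edges s) ≡⟨ cong (2 *_) (^-distribˡ-+-* 2 (edges t) (edges s)) ⟨
    2 ^ edges (join t s)           ∎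
    where open ≤-Reasoning

open Weights

-- Isomorphisms of rooted and unrooted trees; finding a pendant `P₂` or twin leaves.

module Isomorphism where

  open import Data.Nat.Base using (suc; _+_; _*_)
  open import Data.Nat.Properties
  open import Data.Nat.Tactic.RingSolver using (solve-∀)
  open import Data.Product.Base using (_,_)
  open import Relation.Binary.PropositionalEquality
    using (_≡_; refl; sym; trans; cong; cong₂; subst₂)
  open import Data.Sum.Base as Sum using (_⊎_; inj₁; inj₂; swap)
  open import Data.Sum.Properties using (≡-dec; swap-involutive)
  open import Data.Unit.Base using (⊤; tt)
  open import Data.Empty using (⊥)
  import Data.Unit.Properties as Unit
  open import Relation.Nullary.Decidable using (no)
  open import Data.List.Base using (List; []; _∷_; foldl)
  open import Function.Base using (id; _∘_)
  open import Function.Bundles using (_↔_; mk↔ₛ′; mk⇔; Inverse; Equivalence)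
  open import Function.Properties.Inverse using (↔-refl; ↔-sym; ↔-trans)
  open import Relation.Binary.Definitions using (DecidableEquality)
  open Inverse using (strictlyInverseˡ; strictlyInverseʳ)

  Hom : {V W : Set} → Graph V → Graph W → (V → W) → Set
  Hom G H φ = ∀ v w → Graph._~_ G v w → Graph._~_ H (φ v) (φ w)

  mk≅ : {V W : Set} {G : Graph V} {H : Graph W} (V↔W : V ↔ W) →
        Hom G H (Inverse.to V↔W) → Hom H G (Inverse.from V↔W) → G ≅ H
  mk≅ {G = G} V↔W to-hom from-hom = record
    { bijection = V↔W
    ; preserves = λ v w → mk⇔ (to-hom v w) λ e →
        subst₂ (Graph._~_ G) (strictlyInverseʳ V↔W v) (strictlyInverseʳ V↔W w) (from-hom _ _ e) }

  module _ {V W : Set} {G : Graph V} {H : Graph W} (G≅H : G ≅ H) where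
    open _≅_ G≅H

    to-hom : Hom G H to
    to-hom v w = Equivalence.to (preserves v w)

    from-hom : Hom H G from
    from-hom v w e = Equivalence.from (preserves _ _)
      (subst₂ (Graph._~_ H) (sym (strictlyInverseˡ bijection v)) (sym (strictlyInverseˡ bijection w)) e)

  ≅-refl : {V : Set} {G : Graph V} → G ≅ G
  ≅-refl = mk≅ ↔-refl (λ _ _ → id) (λ _ _ → id)

  ≅-sym : {V W : Set} {G : Graph V} {H : Graph W} → G ≅ H → H ≅ G
  ≅-sym G≅H = mk≅ (↔-sym (_≅_.bijection G≅H)) (from-hom G≅H) (to-hom G≅H)

  ≅-trans : {U V W : Set} {F : Graph U} {G : Graph V} {H : Graph W} → F ≅ G → G ≅ H → F ≅ H
  ≅-trans F≅G G≅H = mk≅ (↔-trans (_≅_.bijection F≅G) (_≅_.bijection G≅H))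
    (λ v w → to-hom G≅H _ _ ∘ to-hom F≅G v w)
    (λ v w → from-hom F≅G _ _ ∘ from-hom G≅H v w)

  Vertex : Tree → Set
  Vertex leaf       = ⊤
  Vertex (join t s) = Vertex t ⊎ Vertex s

  _≟ⱽ_ : ∀ {t} → DecidableEquality (Vertex t)
  _≟ⱽ_ {leaf}     = Unit._≟_
  _≟ⱽ_ {join t s} = ≡-dec _≟ⱽ_ _≟ⱽ_

  root : ∀ t → Vertex t
  root leaf       = tt
  root (join t s) = inj₁ (root t)

  graph : ∀ t → Graph (Vertex t)
  graph leaf = record
    { _~_ = λ _ _ → ⊥ ; _~?_ = λ _ _ → no id ; ~-sym = id ; ~-irrefl = id }
  graph (join t s) = Attach.attach _≟ⱽ_ (graph t) (root t) (graph s) (_≟ⱽ root s)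

  infix 4 _≈ʳ_ _≈_

  -- The weights are computed from terms, not from graphs, so every rearrangement carries their
  -- equality along with the isomorphism. Moving the root preserves only σ, whence the weaker `_≈_`.
  record _≈ʳ_ (t u : Tree) : Set where
    field
      iso    : graph t ≅ graph u
      root≡  : _≅_.to iso (root t) ≡ root u
      edges≡ : edges t ≡ edges u
      α≡     : α t ≡ α u
      β≡     : β t ≡ β u
      γ≡     : γ t ≡ γ u

  record _≈_ (t u : Tree) : Set where
    field
      iso    : graph t ≅ graph u
      edges≡ : edges t ≡ edges u
      σ≡     : σ t ≡ σ u

  ≈ʳ⇒≈ : ∀ {t u} → t ≈ʳ u → t ≈ u
  ≈ʳ⇒≈ e = record { iso = iso ; edges≡ = edges≡ ; σ≡ = cong₂ _+_ α≡ (cong₂ _+_ β≡ γ≡) }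
    where open _≈ʳ_ e

  ≈ʳ-refl : ∀ {t} → t ≈ʳ t
  ≈ʳ-refl = record
    { iso = ≅-refl ; root≡ = refl ; edges≡ = refl ; α≡ = refl ; β≡ = refl ; γ≡ = refl }

  ≈ʳ-trans : ∀ {t u v} → t ≈ʳ u → u ≈ʳ v → t ≈ʳ v
  ≈ʳ-trans e f = record
    { iso = ≅-trans E.iso F.iso
    ; root≡ = trans (cong (_≅_.to F.iso) E.root≡) F.root≡
    ; edges≡ = trans E.edges≡ F.edges≡
    ; α≡ = trans E.α≡ F.α≡ ; β≡ = trans E.β≡ F.β≡ ; γ≡ = trans E.γ≡ F.γ≡ }
    where
    module E = _≈ʳ_ e
    module F = _≈ʳ_ f

  ≈-trans : ∀ {t u v} → t ≈ u → u ≈ v → t ≈ v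
  ≈-trans e f = record
    { iso = ≅-trans E.iso F.iso
    ; edges≡ = trans E.edges≡ F.edges≡
    ; σ≡ = trans E.σ≡ F.σ≡ }
    where
    module E = _≈_ e
    module F = _≈_ f

  join-congˡ : ∀ {t u} s → t ≈ʳ u → join t s ≈ʳ join u s
  join-congˡ {t} {u} s t≈u = record
    { iso = mk≅ (mk↔ₛ′ (Sum.map to id) (Sum.map from id) inverseˡ inverseʳ) to-hom′ from-hom′
    ; root≡ = cong inj₁ root≡
    ; edges≡ = cong (λ k → suc (k + edges s)) edges≡
    ; α≡ = cong (_* σ s) α≡
    ; β≡ = cong (_* α s) β≡
    ; γ≡ = cong₂ (λ c b → c * α s + b * β s) γ≡ β≡ }
    where
    open _≈ʳ_ t≈u
    open _≅_ iso
    inverseˡ : ∀ x → Sum.map to id (Sum.map from id x) ≡ x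
    inverseˡ (inj₁ x) = cong inj₁ (strictlyInverseˡ bijection x)
    inverseˡ (inj₂ _) = refl
    inverseʳ : ∀ x → Sum.map from id (Sum.map to id x) ≡ x
    inverseʳ (inj₁ x) = cong inj₁ (strictlyInverseʳ bijection x)
    inverseʳ (inj₂ _) = refl
    from-root : from (root u) ≡ root t
    from-root = trans (cong from (sym root≡)) (strictlyInverseʳ bijection (root t))
    to-hom′ : Hom (graph (join t s)) (graph (join u s)) (Sum.map to id)
    to-hom′ (inj₁ x) (inj₁ y) e = to-hom iso x y e
    to-hom′ (inj₁ x) (inj₂ y) (e , e′) = trans (cong to e) root≡ , e′
    to-hom′ (inj₂ x) (inj₁ y) (e , e′) = trans (cong to e) root≡ , e′
    to-hom′ (inj₂ x) (inj₂ y) e = e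
    from-hom′ : Hom (graph (join u s)) (graph (join t s)) (Sum.map from id)
    from-hom′ (inj₁ x) (inj₁ y) e = from-hom iso x y e
    from-hom′ (inj₁ x) (inj₂ y) (e , e′) = trans (cong from e) from-root , e′
    from-hom′ (inj₂ x) (inj₁ y) (e , e′) = trans (cong from e) from-root , e′
    from-hom′ (inj₂ x) (inj₂ y) e = e

  -- The one move that changes the root: the recursion for σ is symmetric in the two sides of the
  -- joining edge, those for α, β and γ are not.
  join-flip : ∀ t s → join t s ≈ join s t
  join-flip t s = record
    { iso = mk≅ (mk↔ₛ′ swap swap swap-involutive swap-involutive) (hom t s) (hom s t)
    ; edges≡ = cong suc (+-comm (edges t) (edges s))
    ; σ≡ = ring (α t) (β t) (γ t) (α s) (β s) (γ s) }
    where
    hom : ∀ t s → Hom (graph (join t s)) (graph (join s t)) swap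
    hom t s (inj₁ x) (inj₁ y) e = e
    hom t s (inj₁ x) (inj₂ y) (e , e′) = e′ , e
    hom t s (inj₂ x) (inj₁ y) (e , e′) = e′ , e
    hom t s (inj₂ x) (inj₂ y) e = e
    ring : ∀ a b c a′ b′ c′ →
           a * (a′ + (b′ + c′)) + (b * a′ + (c * a′ + b * b′)) ≡
           a′ * (a + (b + c)) + (b′ * a + (c′ * a + b′ * b))
    ring = solve-∀

  join-swap : ∀ t s u → join (join t s) u ≈ʳ join (join t u) s
  join-swap t s u = record
    { iso = mk≅ (mk↔ₛ′ (exchange {t} {s} {u}) (exchange {t} {u} {s})
                       (involutive {t} {u} {s}) (involutive {t} {s} {u}))
                (hom t s u) (hom t u s)
    ; root≡ = refl
    ; edges≡ = ring₁ (edges t) (edges s) (edges u)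
    ; α≡ = ring₂ (α t) (σ s) (σ u)
    ; β≡ = ring₂ (β t) (α s) (α u)
    ; γ≡ = ring₃ (β t) (γ t) (α s) (β s) (α u) (β u) }
    where
    exchange : ∀ {t s u} → Vertex (join (join t s) u) → Vertex (join (join t u) s)
    exchange (inj₁ (inj₁ x)) = inj₁ (inj₁ x)
    exchange (inj₁ (inj₂ x)) = inj₂ x
    exchange (inj₂ x)        = inj₁ (inj₂ x)
    involutive : ∀ {t s u} x → exchange {t} {u} {s} (exchange {t} {s} {u} x) ≡ x
    involutive (inj₁ (inj₁ x)) = refl
    involutive (inj₁ (inj₂ x)) = refl
    involutive (inj₂ x)        = refl
    hom : ∀ t s u → Hom (graph (join (join t s) u)) (graph (join (join t u) s)) exchange
    hom t s u (inj₁ (inj₁ x)) (inj₁ (inj₁ y)) e = e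
    hom t s u (inj₁ (inj₁ x)) (inj₁ (inj₂ y)) (refl , e) = refl , e
    hom t s u (inj₁ (inj₁ x)) (inj₂ y) (refl , e) = refl , e
    hom t s u (inj₁ (inj₂ x)) (inj₁ (inj₁ y)) (refl , e) = refl , e
    hom t s u (inj₁ (inj₂ x)) (inj₁ (inj₂ y)) e = e
    hom t s u (inj₁ (inj₂ x)) (inj₂ y) (() , _)
    hom t s u (inj₂ x) (inj₁ (inj₁ y)) (refl , e) = refl , e
    hom t s u (inj₂ x) (inj₁ (inj₂ y)) (() , _)
    hom t s u (inj₂ x) (inj₂ y) e = e
    ring₁ : ∀ x y z → suc (suc (x + y) + z) ≡ suc (suc (x + z) + y)
    ring₁ = solve-∀
    ring₂ : ∀ x y z → x * y * z ≡ x * z * y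
    ring₂ = solve-∀
    ring₃ : ∀ b c a₁ b₁ a₂ b₂ →
            (c * a₁ + b * b₁) * a₂ + b * a₁ * b₂ ≡ (c * a₂ + b * b₂) * a₁ + b * a₂ * b₁
    ring₃ = solve-∀

  joins : Tree → List Tree → Tree
  joins = foldl join

  -- Repeated `join-swap` carries the branch `s` past all later branches.
  joins-join : ∀ t s us → joins (join t s) us ≈ʳ join (joins t us) s
  joins-join t s []       = ≈ʳ-refl
  joins-join t s (u ∷ us) = ≈ʳ-trans (joins-congˡ us (join-swap t s u)) (joins-join (join t u) s us)
    where
    joins-congˡ : ∀ {t u} us → t ≈ʳ u → joins t us ≈ʳ joins u us
    joins-congˡ []       t≈u = t≈u
    joins-congˡ (s ∷ us) t≈u = joins-congˡ us (join-congˡ s t≈u)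

  -- The vertex of attachment must be the root of `v` for the weights of `v` to apply; it may be far
  -- from the root of `t`, so the comparison is unrooted.
  data Reducible (t : Tree) : Set where
    pendant : ∀ v → t ≈ join v P₂ → Reducible t
    twins   : ∀ v → t ≈ join (join v leaf) leaf → Reducible t

  Reducible-resp-≈ : ∀ {t u} → t ≈ u → Reducible u → Reducible t
  Reducible-resp-≈ t≈u (pendant v u≈) = pendant v (≈-trans t≈u u≈)
  Reducible-resp-≈ t≈u (twins v u≈)   = twins v (≈-trans t≈u u≈)

  -- Generalising over subtrees us attached at the root lets the induction move
  -- the root into a child.
  reducible : ∀ t → t ≡ leaf ⊎ t ≡ P₂ ⊎ (∀ us → Reducible (joins t us))
  reducible leaf = inj₁ refl
  reducible (join t s) with reducible s
  ... | inj₂ (inj₁ refl) = inj₂ (inj₂ λ us → pendant (joins t us) (≈ʳ⇒≈ (joins-join t P₂ us)))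
  ... | inj₂ (inj₂ found) = inj₂ (inj₂ λ us → Reducible-resp-≈
          (≈-trans (≈ʳ⇒≈ (joins-join t s us)) (join-flip (joins t us) s)) (found (joins t us ∷ [])))
  ... | inj₁ refl with reducible t
  ...   | inj₁ refl = inj₂ (inj₁ refl)
  ...   | inj₂ (inj₁ refl) = inj₂ (inj₂ λ us → twins (joins leaf us)
            (≈ʳ⇒≈ (≈ʳ-trans (joins-join P₂ leaf us) (join-congˡ leaf (joins-join leaf leaf us)))))
  ...   | inj₂ (inj₂ found) = inj₂ (inj₂ λ us → found (leaf ∷ us))

open Isomorphism

-- The upper bound and its extremal trees.

module Maximum where

  open import Data.Nat.Base using (ℕ; zero; suc; _+_; _*_; _^_; _≤_; _<_; z<s; s≤s⁻¹)
  open import Data.Nat.Properties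
  open import Data.Nat.Tactic.RingSolver using (solve-∀)
  open import Data.Product.Base using (_×_; _,_; proj₁; proj₂)
  open import Relation.Binary.PropositionalEquality
    using (_≡_; refl; sym; trans; cong; cong₂; subst; subst₂)
  open import Relation.Nullary.Negation using (contradiction)
  open import Data.Sum.Base using (inj₁; inj₂)
  open import Data.List.Base using ([])

  spider : Tree → ℕ → Tree
  spider t zero    = t
  spider t (suc m) = join (spider t m) P₂

  join-spider-leaf : ∀ m → join (spider leaf m) leaf ≈ʳ spider P₂ m
  join-spider-leaf zero    = ≈ʳ-refl
  join-spider-leaf (suc m) = ≈ʳ-trans (join-swap (spider leaf m) P₂ leaf) (join-congˡ P₂ (join-spider-leaf m))

  -- Attaching P₂ at the root raises σ to 2 σ + δ; attaching a second leaf next to one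
  -- already hanging at the root raises σ by the δ of the tree without these leaves.
  δ : Tree → ℕ
  δ t = 2 * α t + β t

  -- The value of δ at the centre of a spider with `k` edges, where α is 2^k and β is `h k`.
  δ-bound : ℕ → ℕ
  δ-bound k = 2 * 2 ^ k + h k

  σ-join-P₂ : ∀ t → σ (join t P₂) ≡ 2 * σ t + δ t
  σ-join-P₂ t = ring (α t) (β t) (γ t)
    where
    ring : ∀ a b c → a * 4 + (b * 2 + (c * 2 + b * 1)) ≡ 2 * (a + (b + c)) + (2 * a + b)
    ring = solve-∀

  δ-join-P₂ : ∀ t → δ (join t P₂) ≡ 4 * α t + 2 * δ t
  δ-join-P₂ t = ring (α t) (β t)
    where
    ring : ∀ a b → 2 * (a * 4) + b * 2 ≡ 4 * a + 2 * (2 * a + b)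
    ring = solve-∀

  -- Repeats `σ-join-P₂` with each weight replaced by its maximum, as `δ-bound-2+` does for
  -- `δ-join-P₂`; this allows comparison summand by summand.
  bound-2+ : ∀ k → bound (2 + k) ≡ 2 * bound k + δ-bound k
  bound-2+ k = ring (2 ^ k) (ε k) (h k)
    where
    ring : ∀ x e y → 2 * (2 * x) + (2 * e + y) ≡ 2 * (x + e) + (2 * x + y)
    ring = solve-∀

  δ-bound-2+ : ∀ k → δ-bound (2 + k) ≡ 4 * 2 ^ k + 2 * δ-bound k
  δ-bound-2+ k = ring (2 ^ k) (h k)
    where
    ring : ∀ x y → 2 * (2 * (2 * x)) + 2 * y ≡ 4 * x + 2 * (2 * x + y)
    ring = solve-∀

  -- The exceptional case is where the path P₆ comes from.
  data Shape (t : Tree) : Set where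
    odd-spider  : ∀ m → t ≈ʳ spider leaf m → Shape t
    even-spider : ∀ m → t ≈ʳ spider P₂ m → Shape t
    exceptional : ∀ s → t ≡ join leaf s → edges s ≡ 2 → Shape t

  -- An even spider has an odd number of edges, and `h` jumps at the next even number.
  h-even-spider : ∀ m → h (edges (spider P₂ m)) < h (suc (edges (spider P₂ m)))
  h-even-spider zero = ≤-refl
  h-even-spider (suc m) rewrite +-comm (edges (spider P₂ m)) 1 = *-monoʳ-< 2 (h-even-spider m)

  -- Separates the branches that multiply α by the full 2·2^q, those with q ≤ 1, from the branches
  -- that lose something.
  data Edges≥2 (t : Tree) : Set where
    is-leaf : t ≡ leaf → Edges≥2 t
    is-P₂   : t ≡ P₂ → Edges≥2 t
    2+      : ∀ j → edges t ≡ 2 + j → Edges≥2 t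

  edges≥2? : ∀ t → Edges≥2 t
  edges≥2? leaf = is-leaf refl
  edges≥2? P₂   = is-P₂ refl
  edges≥2? (join leaf (join s s′)) = 2+ (edges s + edges s′) refl
  edges≥2? (join (join t t′) s)    = 2+ (edges t + edges t′ + edges s) refl

  ≤-<-bound : ∀ {x y z} {A : Set} → x ≤ y → y < z → x ≤ z × (x ≡ z → A)
  ≤-<-bound x≤y y<z = <⇒≤ x<z , λ x≡z → contradiction x≡z (<⇒≢ x<z)
    where x<z = ≤-<-trans x≤y y<z

  -- The recursion peels off the last branch `s` at the root and distinguishes its size. The bound
  -- on σ is assumed for fewer edges only, since it is applied to branches; this avoids circularity
  -- with `optimal`.
  δ≤ : ∀ t → (∀ s → edges s < edges t → σ s ≤ bound (edges s)) →
       δ t ≤ δ-bound (edges t) × (δ t ≡ δ-bound (edges t) → Shape t)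
  δ≤ leaf _ = ≤-refl , λ _ → odd-spider 0 ≈ʳ-refl
  δ≤ (join t s) σ≤ with edges≥2? s
  -- A leaf at the root adds 2·α to δ. Equality also forces `h (suc p) ≡ h p`, that is, p even, so a
  -- second leaf branch cannot occur.
  ... | is-leaf refl rewrite +-identityʳ (edges t) =
    subst₂ _≤_ (sym (ring₁ (α t) (β t))) (sym (ring₂ (2 ^ p) (h (suc p))))
      (+-mono-≤ 2α≤ δ≤h-suc) ,
    λ eq → shape (proj₂ (+-mono-≤-tight 2α≤ δ≤h-suc
             (trans (sym (ring₁ (α t) (β t))) (trans eq (ring₂ (2 ^ p) (h (suc p)))))))
    where
    p = edges t
    ih = δ≤ t (λ s s<t → σ≤ s (m<n⇒m<1+n s<t))
    2α≤ : 2 * α t ≤ 2 * 2 ^ p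
    2α≤ = *-monoʳ-≤ 2 (α≤2^ t)
    δ≤h-suc : δ t ≤ 2 * 2 ^ p + h (suc p)
    δ≤h-suc = ≤-trans (proj₁ ih) (+-monoʳ-≤ (2 * 2 ^ p) (h≤h-suc p))
    ring₁ : ∀ a b → 2 * (a * 2) + b * 1 ≡ 2 * a + (2 * a + b)
    ring₁ = solve-∀
    ring₂ : ∀ x y → 2 * (2 * x) + y ≡ 2 * x + (2 * x + y)
    ring₂ = solve-∀
    shape : δ t ≡ 2 * 2 ^ p + h (suc p) → Shape (join t leaf)
    shape eq = go (proj₂ ih (trans eq (cong (2 * 2 ^ p +_) h-suc≡h)))
      where
      h-suc≡h : h (suc p) ≡ h p
      h-suc≡h = ≤-antisym (+-cancelˡ-≤ (2 * 2 ^ p) _ _ (≤-trans (≤-reflexive (sym eq)) (proj₁ ih))) (h≤h-suc p)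
      go : Shape t → Shape (join t leaf)
      go (odd-spider m t≈)  = even-spider m (≈ʳ-trans (join-congˡ leaf t≈) (join-spider-leaf m))
      go (even-spider m t≈) = contradiction
        (subst (λ k → h (suc k) ≡ h k) (_≈ʳ_.edges≡ t≈) h-suc≡h) (>⇒≢ (h-even-spider m))
      go (exceptional s refl s≡2) = contradiction
        (subst (λ k → h (2 + k) ≡ h (suc k)) s≡2 h-suc≡h) λ ()
  ... | is-P₂ refl rewrite +-comm (edges t) 1 =
    subst₂ _≤_ (sym (δ-join-P₂ t)) (sym (δ-bound-2+ p)) (+-mono-≤ 4α≤ 2δ≤) ,
    λ eq → let 4α≡ , 2δ≡ = +-mono-≤-tight 4α≤ 2δ≤ (trans (sym (δ-join-P₂ t)) (trans eq (δ-bound-2+ p)))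
           in shape (*-cancelˡ-≡ _ _ 4 4α≡) (proj₂ ih (*-cancelˡ-≡ _ _ 2 2δ≡))
    where
    p = edges t
    ih = δ≤ t (λ s s<t → σ≤ s (m<n⇒m<1+n (m<n⇒m<1+n s<t)))
    4α≤ : 4 * α t ≤ 4 * 2 ^ p
    4α≤ = *-monoʳ-≤ 4 (α≤2^ t)
    2δ≤ : 2 * δ t ≤ 2 * δ-bound p
    2δ≤ = *-monoʳ-≤ 2 (proj₁ ih)
    shape : α t ≡ 2 ^ p → Shape t → Shape (join t P₂)
    shape _ (odd-spider m t≈)  = odd-spider (suc m) (join-congˡ P₂ t≈)
    shape _ (even-spider m t≈) = even-spider (suc m) (join-congˡ P₂ t≈)
    -- Here α is σ of a tree with two edges, at most 7, short of the required 2³.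
    shape α≡ (exceptional s refl s≡2) = contradiction α≡ (<⇒≢ (begin-strict
      1 * σ s          ≡⟨ *-identityˡ (σ s) ⟩
      σ s              ≤⟨ σ≤ s (m<n⇒m<1+n (m<n⇒m<1+n ≤-refl)) ⟩
      bound (edges s)  ≡⟨ cong bound s≡2 ⟩
      7                <⟨ ≤-refl ⟩
      2 ^ 3            ≡⟨ cong (λ k → 2 ^ suc k) s≡2 ⟨
      2 ^ suc (edges s) ∎))
      where open ≤-Reasoning
  δ≤ (join leaf s) σ≤ | 2+ j q≡ = go j q≡
    where
    q = edges s
    δ≤′ : δ (join leaf s) ≤ 2 * bound q + 2 ^ q
    δ≤′ = begin
      2 * (1 * σ s) + 1 * α s  ≡⟨ cong₂ _+_ (cong (2 *_) (*-identityˡ (σ s))) (*-identityˡ (α s)) ⟩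
      2 * σ s + α s            ≤⟨ +-mono-≤ (*-monoʳ-≤ 2 (σ≤ s ≤-refl)) (α≤2^ s) ⟩
      2 * bound q + 2 ^ q      ∎
      where open ≤-Reasoning
    go : ∀ j → q ≡ 2 + j →
         δ (join leaf s) ≤ δ-bound (suc q) × (δ (join leaf s) ≡ δ-bound (suc q) → Shape (join leaf s))
    -- For q = 2 both sides are 18, the only tie; for q = 3 it is 34 against 36; from q = 4 on
    -- `ε≤8·2^` leaves at least `h (suc q)` to spare.
    go 0 eq =
      subst (λ q → δ (join leaf s) ≤ 2 * bound q + 2 ^ q → δ (join leaf s) ≤ δ-bound (suc q)) (sym eq) (λ le → le) δ≤′ ,
      λ _ → exceptional s refl eq
    go 1 eq = ≤-<-bound δ≤′ (subst (λ q → 2 * bound q + 2 ^ q < δ-bound (suc q)) (sym eq) (m≤m+n 35 1))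
    go (suc (suc j)) eq = ≤-<-bound δ≤′ (subst (λ q → 2 * bound q + 2 ^ q < δ-bound (suc q)) (sym eq) (begin-strict
      2 * (16x + ε (4 + j)) + 16x    ≤⟨ +-monoˡ-≤ 16x (*-monoʳ-≤ 2 (+-monoʳ-≤ 16x (ε≤8·2^ j))) ⟩
      2 * (16x + 8 * 2 ^ j) + 16x    ≡⟨ ring (2 ^ j) ⟩
      2 * (2 * 16x)                  ≡⟨ +-identityʳ _ ⟨
      2 * (2 * 16x) + 0              <⟨ +-monoʳ-< (2 * (2 * 16x)) (0<h (5 + j)) ⟩
      2 * (2 * 16x) + h (5 + j)      ∎))
      where
      open ≤-Reasoning
      16x = 2 ^ (4 + j)
      ring : ∀ x → 2 * (2 * (2 * (2 * (2 * x))) + 8 * x) + 2 * (2 * (2 * (2 * x))) ≡ 2 * (2 * (2 * (2 * (2 * (2 * x)))))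
      ring = solve-∀
  -- With A = 2^(edges t) and J = 2^j: the large branch leaves 14·A·J of the possible 16·A·J in 2·α,
  -- and since `t` has an edge, β contributes at most the missing 2·A·J. The term `h` of the bound
  -- then gives strictness.
  δ≤ (join t@(join t₁ t₂) s) σ≤ | 2+ j q≡ = ≤-<-bound (begin
      2 * (α t * σ s) + β t * α s              ≤⟨ +-mono-≤ (*-monoʳ-≤ 2 (*-mono-≤ (α≤2^ t) σs≤)) (*-monoʳ-≤ (β t) αs≤) ⟩
      2 * (A * (4 * J + 3 * J)) + β t * (4 * J) ≡⟨ ring₁ A J (β t) ⟩
      14 * (A * J) + 2 * β t * (2 * J)         ≤⟨ +-monoʳ-≤ (14 * (A * J)) (*-monoˡ-≤ (2 * J) (2β-join≤2^ t₁ t₂)) ⟩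
      14 * (A * J) + A * (2 * J)               ≡⟨ ring₂ A J ⟩
      4 * (A * (4 * J))                        ≡⟨ cong (λ z → 4 * (A * z)) 4J≡ ⟩
      4 * (A * 2 ^ edges s)                    ≡⟨ cong (4 *_) (^-distribˡ-+-* 2 (edges t) (edges s)) ⟨
      4 * 2 ^ (edges t + edges s)              ≡⟨ ring₃ (2 ^ (edges t + edges s)) ⟩
      2 * (2 * 2 ^ (edges t + edges s))        ∎)
    (m<m+n _ (0<h (suc (edges t + edges s))))
    where
    open ≤-Reasoning
    A = 2 ^ edges t
    J = 2 ^ j
    ring₀ : ∀ x → 4 * x ≡ 2 * (2 * x)
    ring₀ = solve-∀
    4J≡ : 4 * J ≡ 2 ^ edges s
    4J≡ = trans (ring₀ J) (cong (2 ^_) (sym q≡))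
    αs≤ : α s ≤ 4 * J
    αs≤ = subst (α s ≤_) (sym 4J≡) (α≤2^ s)
    σs≤ : σ s ≤ 4 * J + 3 * J
    σs≤ = begin
      σ s                    ≤⟨ σ≤ s (m<n+m (edges s) z<s) ⟩
      bound (edges s)        ≡⟨ cong₂ _+_ (sym 4J≡) (cong ε q≡) ⟩
      4 * J + ε (2 + j)      ≤⟨ +-monoʳ-≤ (4 * J) (ε≤3·2^ j) ⟩
      4 * J + 3 * J          ∎
    ring₁ : ∀ a x b → 2 * (a * (4 * x + 3 * x)) + b * (4 * x) ≡ 14 * (a * x) + 2 * b * (2 * x)
    ring₁ = solve-∀
    ring₂ : ∀ a x → 14 * (a * x) + a * (2 * x) ≡ 4 * (a * (4 * x))
    ring₂ = solve-∀
    ring₃ : ∀ x → 4 * x ≡ 2 * (2 * x)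
    ring₃ = solve-∀

  data Extremal (t : Tree) : Set where
    odd-spider  : ∀ m → t ≈ spider leaf m → Extremal t
    even-spider : ∀ m → t ≈ spider P₂ m → Extremal t
    six-path    : t ≈ join (join leaf P₃) P₂ → Extremal t

  Optimal : Tree → Set
  Optimal t = σ t ≤ bound (edges t) × (σ t ≡ bound (edges t) → Extremal t)

  Optimal-resp-≈ : ∀ {t u} → t ≈ u → Optimal u → Optimal t
  Optimal-resp-≈ {t} {u} t≈u (σ≤ , extremal) =
    subst₂ _≤_ (sym σ≡) (cong bound (sym edges≡)) σ≤ ,
    λ eq → transport (extremal (trans (sym σ≡) (trans eq (cong bound edges≡))))
    where
    open _≈_ t≈u
    transport : Extremal u → Extremal t
    transport (odd-spider m u≈)  = odd-spider m (≈-trans t≈u u≈)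
    transport (even-spider m u≈) = even-spider m (≈-trans t≈u u≈)
    transport (six-path u≈)      = six-path (≈-trans t≈u u≈)

  optimal-pendant : ∀ v → (∀ s → edges s < edges (join v P₂) → σ s ≤ bound (edges s)) → Optimal (join v P₂)
  optimal-pendant v σ≤ rewrite +-comm (edges v) 1 =
    subst₂ _≤_ (sym (σ-join-P₂ v)) (sym (bound-2+ p)) (+-mono-≤ 2σ≤ (proj₁ δ≤-v)) ,
    λ eq → let 2σ≡ , δ≡ = +-mono-≤-tight 2σ≤ (proj₁ δ≤-v) (trans (sym (σ-join-P₂ v)) (trans eq (bound-2+ p)))
           in extremal (*-cancelˡ-≡ _ _ 2 2σ≡) (proj₂ δ≤-v δ≡)
    where
    p = edges v
    δ≤-v = δ≤ v (λ s s<v → σ≤ s (m<n⇒m<1+n (m<n⇒m<1+n s<v)))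
    2σ≤ : 2 * σ v ≤ 2 * bound p
    2σ≤ = *-monoʳ-≤ 2 (σ≤ v (m<n⇒m<1+n ≤-refl))
    extremal : σ v ≡ bound p → Shape v → Extremal (join v P₂)
    extremal _ (odd-spider m v≈)  = odd-spider (suc m) (≈ʳ⇒≈ (join-congˡ P₂ v≈))
    extremal _ (even-spider m v≈) = even-spider (suc m) (≈ʳ⇒≈ (join-congˡ P₂ v≈))
    -- Two edges leave two rooted terms for `s`. Rooted at an end, it yields `P₆`; rooted at its
    -- centre, it makes `v` a star with three leaves, and σ is 12 instead of 13.
    extremal _ (exceptional P₃ refl _) = six-path (≈ʳ⇒≈ ≈ʳ-refl)
    extremal σ≡ (exceptional (join P₂ leaf) refl _) = contradiction σ≡ λ ()
    extremal _ (exceptional (join leaf leaf) refl ())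
    extremal _ (exceptional (join leaf (join leaf (join _ _))) refl ())
    extremal _ (exceptional (join leaf (join (join _ _) _)) refl ())
    extremal _ (exceptional (join (join leaf leaf) (join _ _)) refl ())
    extremal _ (exceptional (join (join leaf (join _ _)) _) refl ())
    extremal _ (exceptional (join (join (join _ _) _) _) refl ())

  -- The second leaf adds δ of `v` to σ. Against `bound (2 + p)` this amounts to comparing
  -- `ε (suc p)` with 2·`ε p`, a tie only if `v` is a single vertex.
  optimal-twins : ∀ v → (∀ s → edges s < edges (join (join v leaf) leaf) → σ s ≤ bound (edges s)) →
                  Optimal (join (join v leaf) leaf)
  optimal-twins v σ≤ rewrite +-identityʳ (edges v) | +-identityʳ (edges v) =
    subst (_≤ bound (2 + p)) (sym (ring₁ (α v) (β v) (γ v))) (≤-trans σ+δ≤ bound≤) ,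
    λ eq → extremal v (trans (sym (ring₁ (α v) (β v) (γ v))) eq) σ+δ≤
    where
    p = edges v
    δ≤-v = δ≤ v (λ s s<v → σ≤ s (m<n⇒m<1+n (m<n⇒m<1+n s<v)))
    σ+δ≤ : σ (join v leaf) + δ v ≤ bound (suc p) + δ-bound p
    σ+δ≤ = +-mono-≤ (subst (λ k → σ (join v leaf) ≤ bound (suc k)) (+-identityʳ p)
                      (σ≤ (join v leaf) (≤-reflexive (cong (2 +_) (+-identityʳ p)))))
                    (proj₁ δ≤-v)
    ring₁ : ∀ a b c → (a * 2) * 2 + (b * 1 * 1 + ((c * 1 + b * 1) * 1 + b * 1 * 1)) ≡
                      (a * 2 + (b * 1 + (c * 1 + b * 1))) + (2 * a + b)
    ring₁ = solve-∀
    ring₂ : ∀ x e y → (2 * x + e) + (2 * x + y) ≡ 2 * (2 * x) + (e + y)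
    ring₂ = solve-∀
    bound≤ : bound (suc p) + δ-bound p ≤ bound (2 + p)
    bound≤ = subst (_≤ bound (2 + p)) (sym (ring₂ (2 ^ p) (ε (suc p)) (h p)))
      (+-monoʳ-≤ (2 * (2 * 2 ^ p)) (+-monoˡ-≤ (h p) (ε-suc≤2ε p)))
    extremal : ∀ v → σ (join v leaf) + δ v ≡ bound (2 + edges v) →
               σ (join v leaf) + δ v ≤ bound (suc (edges v)) + δ-bound (edges v) →
               Extremal (join (join v leaf) leaf)
    extremal leaf _ _ = odd-spider 1 (join-flip P₂ leaf)
    extremal (join v v′) eq le = contradiction eq (<⇒≢ (≤-<-trans le (strict (edges v + edges v′))))
      where
      strict : ∀ k → bound (2 + k) + δ-bound (suc k) < bound (3 + k)
      strict k = subst (_< bound (3 + k)) (sym (ring₂ (2 ^ suc k) (ε (2 + k)) (h (suc k))))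
        (+-monoʳ-< (2 * (2 * 2 ^ suc k)) (+-monoˡ-< (h (suc k)) (ε-suc<2ε k)))

  optimal : ∀ t → Optimal t
  optimal t = go (suc (edges t)) t ≤-refl
    where
    -- The reductions lead to trees that are not subterms of `t`, so the recursion descends on a
    -- strict upper bound for the number of edges.
    go : ∀ fuel t → edges t < fuel → Optimal t
    go (suc fuel) t t<fuel with reducible t
    ... | inj₁ refl = ≤-refl , λ _ → odd-spider 0 (≈ʳ⇒≈ ≈ʳ-refl)
    ... | inj₂ (inj₁ refl) = ≤-refl , λ _ → even-spider 0 (≈ʳ⇒≈ ≈ʳ-refl)
    ... | inj₂ (inj₂ found) = reduce (found [])
      where
      ih : ∀ {u} → t ≈ u → ∀ s → edges s < edges u → σ s ≤ bound (edges s)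
      ih t≈u s s<u = proj₁ (go fuel s (<-≤-trans s<u (subst (_≤ fuel) (_≈_.edges≡ t≈u) (s≤s⁻¹ t<fuel))))
      reduce : Reducible t → Optimal t
      reduce (pendant v t≈) = Optimal-resp-≈ t≈ (optimal-pendant v (ih t≈))
      reduce (twins v t≈)   = Optimal-resp-≈ t≈ (optimal-twins v (ih t≈))

  -- The three equalities must travel together: attaching `P₂` expresses the new σ through δ and the
  -- new δ through α.
  Tight : Tree → Set
  Tight t = α t ≡ 2 ^ edges t × δ t ≡ δ-bound (edges t) × σ t ≡ bound (edges t)

  join-P₂-tight : ∀ t → Tight t → Tight (join t P₂)
  join-P₂-tight t (α≡ , δ≡ , σ≡) rewrite +-comm (edges t) 1 =
    trans (cong (_* 4) α≡) (ring (2 ^ edges t)) ,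
    trans (δ-join-P₂ t) (trans (cong₂ (λ a d → 4 * a + 2 * d) α≡ δ≡) (sym (δ-bound-2+ (edges t)))) ,
    trans (σ-join-P₂ t) (trans (cong₂ (λ n d → 2 * n + d) σ≡ δ≡) (sym (bound-2+ (edges t))))
    where
    ring : ∀ x → x * 4 ≡ 2 * (2 * x)
    ring = solve-∀

  spider-tight : ∀ t → Tight t → ∀ m → Tight (spider t m)
  spider-tight t tight zero    = tight
  spider-tight t tight (suc m) = join-P₂-tight (spider t m) (spider-tight t tight m)

  leaf-tight : Tight leaf
  leaf-tight = refl , refl , refl

  P₂-tight : Tight P₂
  P₂-tight = refl , refl , refl

open Maximum

-- The dissociation sets of the graph of `t` number `σ t`.

module Counting where

  open import Data.Nat.Base using (ℕ; zero; suc; _+_; _*_; _≤_; z≤n; s≤s; s≤s⁻¹)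
  open import Data.Nat.Properties
  open import Data.Bool.Base using (Bool; true; false; _∧_)
  open import Data.Fin.Base using (Fin; zero; suc)
  import Data.Fin.Properties as Fin
  open import Data.Fin.Subset using (Subset; inside; outside; _∩_; ∣_∣)
  open import Data.List.Base as List using (List; []; _∷_; _++_; map; length; cartesianProduct)
  open import Data.List.Properties using (length-++; length-map)
  open import Data.List.Membership.Propositional using (_∈_)
  open import Data.List.Membership.Propositional.Properties
    using (∈-lookup; ∈-++⁺ˡ; ∈-++⁺ʳ; ∈-++⁻; ∈-map⁺; ∈-map⁻; ∈-filter⁺; ∈-filter⁻;
           ∈-cartesianProduct⁺; ∈-cartesianProduct⁻)
  open import Data.List.Relation.Binary.Disjoint.Propositional using (Disjoint)
  import Data.List.Relation.Unary.All as All
  open import Data.List.Relation.Unary.AllPairs using ([]; _∷_)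
  open import Data.List.Relation.Unary.Any using (here; index)
  open import Data.List.Relation.Unary.Any.Properties using (lookup-index)
  open import Data.List.Relation.Unary.Unique.Propositional using (Unique)
  open import Data.List.Relation.Unary.Unique.Propositional.Properties as Unique using ()
  open import Data.Product.Base using (_×_; _,_; proj₁; proj₂; ∃-syntax)
  open import Data.Sum.Base using (_⊎_; inj₁; inj₂)
  open import Data.Sum.Properties using (inj₁-injective; inj₂-injective)
  open import Data.Vec.Base using ([]; _∷_; lookup; tabulate)
  open import Data.Vec.Properties
    using ([]=⇒lookup; lookup⇒[]=; tabulate∘lookup; lookup∘tabulate; tabulate-cong;
           lookup-zipWith; ∷-injectiveʳ)
  open import Data.Unit.Base using (tt)
  open import Function.Base using (_∘_)
  open import Function.Bundles using (Inverse)
  open import Relation.Binary.PropositionalEquality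
    using (_≡_; _≢_; refl; sym; trans; cong; cong₂; subst; _≗_)
  open import Relation.Nullary.Decidable using (does; Dec; yes; dec-true)
  open import Relation.Nullary.Negation using (contradiction)
  open Inverse using (strictlyInverseˡ; strictlyInverseʳ)

  Unique⇒lookup-injective : {A : Set} {xs : List A} → Unique xs →
                            ∀ {i j} → List.lookup xs i ≡ List.lookup xs j → i ≡ j
  Unique⇒lookup-injective (_ ∷ _) {zero}  {zero}  _  = refl
  Unique⇒lookup-injective (x∉xs ∷ _) {zero}  {suc j} eq = contradiction eq (All.lookup x∉xs (∈-lookup j))
  Unique⇒lookup-injective (x∉xs ∷ _) {suc i} {zero}  eq = contradiction (sym eq) (All.lookup x∉xs (∈-lookup i))
  Unique⇒lookup-injective (_ ∷ u) {suc i} {suc j} eq = cong suc (Unique⇒lookup-injective u eq)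

  -- Each index of `xs` is sent to the position of its image in `ys`, an injection between finite
  -- ordinals.
  Unique-injection⇒length≤ : {A B : Set} {xs : List A} {ys : List B} (f : A → B) →
    (∀ {x x′} → f x ≡ f x′ → x ≡ x′) → Unique xs → (∀ {x} → x ∈ xs → f x ∈ ys) →
    length xs ≤ length ys
  Unique-injection⇒length≤ {xs = xs} {ys} f f-inj unique f∈ = Fin.injective⇒≤ {f = position} position-injective
    where
    position : Fin (length xs) → Fin (length ys)
    position i = index (f∈ (∈-lookup i))
    position-injective : ∀ {i j} → position i ≡ position j → i ≡ j
    position-injective {i} {j} eq = Unique⇒lookup-injective unique (f-inj
      (trans (lookup-index (f∈ (∈-lookup i)))
             (trans (cong (List.lookup ys) eq) (sym (lookup-index (f∈ (∈-lookup j)))))))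

  length-cartesianProduct : {A B : Set} (xs : List A) (ys : List B) →
                            length (cartesianProduct xs ys) ≡ length xs * length ys
  length-cartesianProduct [] ys = refl
  length-cartesianProduct (x ∷ xs) ys = trans (length-++ (map (x ,_) ys))
    (cong₂ _+_ (length-map (x ,_) ys) (length-cartesianProduct xs ys))

  -- Degree at most 1, stated as equality of any two neighbours inside the set: this form makes
  -- sense on every vertex type and moves along isomorphisms.
  Dissociation : {V : Set} → Graph V → (V → Bool) → Set
  Dissociation G χ = ∀ v {w w′} → χ v ≡ true → χ w ≡ true → χ w′ ≡ true → v ~ w → v ~ w′ → w ≡ w′
    where open Graph G

  Dissociation-resp-≅ : {V W : Set} {G : Graph V} {H : Graph W} (G≅H : G ≅ H) {χ : W → Bool} →
                        Dissociation H χ → Dissociation G (χ ∘ _≅_.to G≅H)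
  Dissociation-resp-≅ G≅H diss v v∈ w∈ w′∈ v~w v~w′ =
    trans (sym (strictlyInverseʳ bijection _))
      (trans (cong from (diss (to v) v∈ w∈ w′∈ (to-hom G≅H _ _ v~w) (to-hom G≅H _ _ v~w′)))
             (strictlyInverseʳ bijection _))
    where open _≅_ G≅H

  Dissociation-cong : {V : Set} (G : Graph V) {χ χ′ : V → Bool} → χ ≗ χ′ → Dissociation G χ → Dissociation G χ′
  Dissociation-cong G χ≗χ′ diss v v∈ w∈ w′∈ =
    diss v (trans (χ≗χ′ _) v∈) (trans (χ≗χ′ _) w∈) (trans (χ≗χ′ _) w′∈)

  ∣p∣≡0⇒outside : ∀ {n} (p : Subset n) → ∣ p ∣ ≤ 0 → ∀ i → lookup p i ≢ true
  ∣p∣≡0⇒outside (outside ∷ p) le (suc i) i∈ = ∣p∣≡0⇒outside p le i i∈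

  outside⇒∣p∣≤0 : ∀ {n} (p : Subset n) → (∀ i → lookup p i ≢ true) → ∣ p ∣ ≤ 0
  outside⇒∣p∣≤0 []            _ = z≤n
  outside⇒∣p∣≤0 (inside ∷ p)  ∉ = contradiction refl (∉ zero)
  outside⇒∣p∣≤0 (outside ∷ p) ∉ = outside⇒∣p∣≤0 p (∉ ∘ suc)

  ∣p∣≤1⇒≡ : ∀ {n} (p : Subset n) → ∣ p ∣ ≤ 1 → ∀ {i j} → lookup p i ≡ true → lookup p j ≡ true → i ≡ j
  ∣p∣≤1⇒≡ (_ ∷ _)       _  {zero}  {zero}  _  _  = refl
  ∣p∣≤1⇒≡ (inside ∷ p)  le {zero}  {suc j} _  j∈ = contradiction j∈ (∣p∣≡0⇒outside p (s≤s⁻¹ le) j)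
  ∣p∣≤1⇒≡ (inside ∷ p)  le {suc i} {zero}  i∈ _  = contradiction i∈ (∣p∣≡0⇒outside p (s≤s⁻¹ le) i)
  ∣p∣≤1⇒≡ (inside ∷ p)  le {suc i} {suc j} i∈ j∈ = contradiction j∈ (∣p∣≡0⇒outside p (s≤s⁻¹ le) j)
  ∣p∣≤1⇒≡ (outside ∷ p) le {suc i} {suc j} i∈ j∈ = cong suc (∣p∣≤1⇒≡ p le i∈ j∈)

  ≡⇒∣p∣≤1 : ∀ {n} (p : Subset n) → (∀ {i j} → lookup p i ≡ true → lookup p j ≡ true → i ≡ j) → ∣ p ∣ ≤ 1
  ≡⇒∣p∣≤1 []            _  = z≤n
  ≡⇒∣p∣≤1 (inside ∷ p)  eq = s≤s (outside⇒∣p∣≤0 p λ i i∈ → contradiction (eq {zero} {suc i} refl i∈) λ ())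
  ≡⇒∣p∣≤1 (outside ∷ p) eq = ≡⇒∣p∣≤1 p (λ i∈ j∈ → Fin.suc-injective (eq i∈ j∈))

  module _ {n : ℕ} (G : Graph (Fin n)) where
    open Graph G

    ∈-neighbours⁺ : ∀ D {v w} → v ~ w → lookup D w ≡ true → lookup (neighbours G v ∩ D) w ≡ true
    ∈-neighbours⁺ D {v} {w} v~w w∈ = trans (lookup-zipWith _∧_ w (neighbours G v) D)
      (cong₂ _∧_ (trans (lookup∘tabulate _ w) (dec-true (v ~? w) v~w)) w∈)

    ∈-neighbours⁻ : ∀ D {v w} → lookup (neighbours G v ∩ D) w ≡ true → v ~ w × lookup D w ≡ true
    ∈-neighbours⁻ D {v} {w} w∈ = split (v ~? w) (lookup D w)
      (trans (cong (_∧ lookup D w) (sym (lookup∘tabulate _ w)))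
             (trans (sym (lookup-zipWith _∧_ w (neighbours G v) D)) w∈))
      where
      split : (p : Dec (v ~ w)) (b : Bool) → does p ∧ b ≡ true → v ~ w × b ≡ true
      split (yes v~w) true _ = v~w , refl

    IsDissociation⇒Dissociation : ∀ {D} → IsDissociation G D → Dissociation G (lookup D)
    IsDissociation⇒Dissociation {D} diss v v∈ w∈ w′∈ v~w v~w′ =
      ∣p∣≤1⇒≡ (neighbours G v ∩ D) (diss v (lookup⇒[]= v D v∈))
        (∈-neighbours⁺ D v~w w∈) (∈-neighbours⁺ D v~w′ w′∈)

    Dissociation⇒IsDissociation : ∀ {D} → Dissociation G (lookup D) → IsDissociation G D
    Dissociation⇒IsDissociation {D} diss v v∈ = ≡⇒∣p∣≤1 (neighbours G v ∩ D) λ w∈ w′∈ →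
      let v~w  , w∈D  = ∈-neighbours⁻ D w∈
          v~w′ , w′∈D = ∈-neighbours⁻ D w′∈
      in diss v ([]=⇒lookup v∈) w∈D w′∈D v~w v~w′

  subsets-complete : ∀ {n} (D : Subset n) → D ∈ subsets n
  subsets-complete []            = here refl
  subsets-complete (outside ∷ D) = ∈-++⁺ˡ (∈-map⁺ (outside ∷_) (subsets-complete D))
  subsets-complete (inside ∷ D)  = ∈-++⁺ʳ (map (outside ∷_) (subsets _)) (∈-map⁺ (inside ∷_) (subsets-complete D))

  subsets-unique : ∀ n → Unique (subsets n)
  subsets-unique zero    = All.[] ∷ []
  subsets-unique (suc n) = Unique.++⁺ (Unique.map⁺ ∷-injectiveʳ (subsets-unique n))
                                      (Unique.map⁺ ∷-injectiveʳ (subsets-unique n)) disjoint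
    where
    disjoint : Disjoint (map (outside ∷_) (subsets n)) (map (inside ∷_) (subsets n))
    disjoint (D∈₀ , D∈₁) with ∈-map⁻ (outside ∷_) D∈₀ | ∈-map⁻ (inside ∷_) D∈₁
    ... | _ , _ , refl | _ , _ , ()

  -- Nested pairs instead of functions to `Bool`: sets with the same members become equal
  -- (`member-injective`), as membership and uniqueness in lists require.
  VertexSet : Tree → Set
  VertexSet leaf       = Bool
  VertexSet (join t s) = VertexSet t × VertexSet s

  member : ∀ t → VertexSet t → Vertex t → Bool
  member leaf       b        _        = b
  member (join t s) (χ , χ′) (inj₁ v) = member t χ v
  member (join t s) (χ , χ′) (inj₂ v) = member s χ′ v

  comprehend : ∀ t → (Vertex t → Bool) → VertexSet t
  comprehend leaf       p = p tt
  comprehend (join t s) p = comprehend t (p ∘ inj₁) , comprehend s (p ∘ inj₂)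

  member-comprehend : ∀ t p v → member t (comprehend t p) v ≡ p v
  member-comprehend leaf       p _        = refl
  member-comprehend (join t s) p (inj₁ v) = member-comprehend t (p ∘ inj₁) v
  member-comprehend (join t s) p (inj₂ v) = member-comprehend s (p ∘ inj₂) v

  member-injective : ∀ t {χ χ′} → member t χ ≗ member t χ′ → χ ≡ χ′
  member-injective leaf       eq = eq tt
  member-injective (join t s) eq = cong₂ _,_ (member-injective t (eq ∘ inj₁)) (member-injective s (eq ∘ inj₂))

  Diss : ∀ t → VertexSet t → Set
  Diss t χ = Dissociation (graph t) (member t χ)

  RootOut RootIsolated RootPaired : ∀ t → VertexSet t → Set
  RootOut t χ = Diss t χ × member t χ (root t) ≡ false
  RootIsolated t χ = Diss t χ × member t χ (root t) ≡ true ×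
    (∀ {v} → Graph._~_ (graph t) (root t) v → member t χ v ≡ false)
  RootPaired t χ = Diss t χ × member t χ (root t) ≡ true ×
    ∃[ v ] Graph._~_ (graph t) (root t) v × member t χ v ≡ true

  true≢false : ∀ {b} → b ≡ true → b ≢ false
  true≢false refl ()

  Diss-join⁻ˡ : ∀ t s {χ χ′} → Diss (join t s) (χ , χ′) → Diss t χ
  Diss-join⁻ˡ t s diss v v∈ w∈ w′∈ v~w v~w′ = inj₁-injective (diss (inj₁ v) v∈ w∈ w′∈ v~w v~w′)

  Diss-join⁻ʳ : ∀ t s {χ χ′} → Diss (join t s) (χ , χ′) → Diss s χ′
  Diss-join⁻ʳ t s diss v v∈ w∈ w′∈ v~w v~w′ = inj₂-injective (diss (inj₂ v) v∈ w∈ w′∈ v~w v~w′)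

  -- If both roots are chosen, the joining edge exhausts the degree of each, so neither has a chosen
  -- neighbour on its own side.
  Compatible : ∀ t s → VertexSet (join t s) → Set
  Compatible t s (χ , χ′) = member t χ (root t) ≡ true → member s χ′ (root s) ≡ true →
    (∀ {v} → Graph._~_ (graph t) (root t) v → member t χ v ≡ false) ×
    (∀ {v} → Graph._~_ (graph s) (root s) v → member s χ′ v ≡ false)

  Diss-join⁻ : ∀ t s {χ} → Diss (join t s) χ → Compatible t s χ
  Diss-join⁻ t s {χ , χ′} diss r∈ r′∈ =
    (λ {v} e → ≢true λ v∈ →
      contradiction (diss (inj₁ (root t)) {inj₁ v} {inj₂ (root s)} r∈ v∈ r′∈ e (refl , refl)) λ ()) ,
    (λ {v} e → ≢true λ v∈ →
      contradiction (diss (inj₂ (root s)) {inj₂ v} {inj₁ (root t)} r′∈ v∈ r∈ e (refl , refl)) λ ())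
    where
    ≢true : ∀ {b} → b ≢ true → b ≡ false
    ≢true {false} _ = refl
    ≢true {true}  b≢true = contradiction refl b≢true

  Diss-join⁺ : ∀ t s {χ χ′} → Diss t χ → Diss s χ′ → Compatible t s (χ , χ′) → Diss (join t s) (χ , χ′)
  Diss-join⁺ t s d d′ c (inj₁ v) {inj₁ w} {inj₁ w′} v∈ w∈ w′∈ e e′ = cong inj₁ (d v v∈ w∈ w′∈ e e′)
  Diss-join⁺ t s d d′ c (inj₁ v) {inj₁ w} {inj₂ w′} v∈ w∈ w′∈ e (refl , refl) =
    contradiction (proj₁ (c v∈ w′∈) e) (true≢false w∈)
  Diss-join⁺ t s d d′ c (inj₁ v) {inj₂ w} {inj₁ w′} v∈ w∈ w′∈ (refl , refl) e =
    contradiction (proj₁ (c v∈ w∈) e) (true≢false w′∈)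
  Diss-join⁺ t s d d′ c (inj₁ v) {inj₂ w} {inj₂ w′} _ _ _ (_ , refl) (_ , refl) = refl
  Diss-join⁺ t s d d′ c (inj₂ v) {inj₁ w} {inj₁ w′} _ _ _ (refl , _) (refl , _) = refl
  Diss-join⁺ t s d d′ c (inj₂ v) {inj₁ w} {inj₂ w′} v∈ w∈ w′∈ (refl , refl) e =
    contradiction (proj₂ (c w∈ v∈) e) (true≢false w′∈)
  Diss-join⁺ t s d d′ c (inj₂ v) {inj₂ w} {inj₁ w′} v∈ w∈ w′∈ e (refl , refl) =
    contradiction (proj₂ (c w′∈ v∈) e) (true≢false w∈)
  Diss-join⁺ t s d d′ c (inj₂ v) {inj₂ w} {inj₂ w′} v∈ w∈ w′∈ e e′ = cong inj₂ (d′ v v∈ w∈ w′∈ e e′)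

  classify : ∀ t χ → Diss t χ → RootOut t χ ⊎ RootIsolated t χ ⊎ RootPaired t χ
  classify leaf false diss = inj₁ (diss , refl)
  classify leaf true  diss = inj₂ (inj₁ (diss , refl , λ ()))
  classify (join t s) (χ , χ′) diss with classify t χ (Diss-join⁻ˡ t s diss)
  ... | inj₁ (_ , r∉) = inj₁ (diss , r∉)
  ... | inj₂ (inj₂ (_ , r∈ , v , e , v∈)) = inj₂ (inj₂ (diss , r∈ , inj₁ v , e , v∈))
  ... | inj₂ (inj₁ (_ , r∈ , isolated)) with member s χ′ (root s) in r′
  ...   | true  = inj₂ (inj₂ (diss , r∈ , inj₂ (root s) , (refl , refl) , r′))
  ...   | false = inj₂ (inj₁ (diss , r∈ , λ { {inj₁ _} e → isolated e ; {inj₂ _} (_ , refl) → r′ }))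

  -- Each list copies the recursion of its weight, with cartesian products for products and
  -- concatenation for sums, so that the lengths are α, β, γ and σ.
  outs isolateds paireds dissociations : ∀ t → List (VertexSet t)
  dissociations t = outs t ++ isolateds t ++ paireds t
  outs leaf            = false ∷ []
  outs (join t s)      = cartesianProduct (outs t) (dissociations s)
  isolateds leaf       = true ∷ []
  isolateds (join t s) = cartesianProduct (isolateds t) (outs s)
  paireds leaf         = []
  paireds (join t s)   = cartesianProduct (paireds t) (outs s) ++ cartesianProduct (isolateds t) (isolateds s)

  length-dissociations : ∀ t → length (dissociations t) ≡ σ t
  length-outs          : ∀ t → length (outs t) ≡ α t
  length-isolateds     : ∀ t → length (isolateds t) ≡ β t
  length-paireds       : ∀ t → length (paireds t) ≡ γ t
  length-dissociations t = trans (length-++ (outs t)) (cong₂ _+_ (length-outs t)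
    (trans (length-++ (isolateds t)) (cong₂ _+_ (length-isolateds t) (length-paireds t))))
  length-outs leaf = refl
  length-outs (join t s) = trans (length-cartesianProduct (outs t) (dissociations s))
    (cong₂ _*_ (length-outs t) (length-dissociations s))
  length-isolateds leaf = refl
  length-isolateds (join t s) = trans (length-cartesianProduct (isolateds t) (outs s))
    (cong₂ _*_ (length-isolateds t) (length-outs s))
  length-paireds leaf = refl
  length-paireds (join t s) = trans (length-++ (cartesianProduct (paireds t) (outs s))) (cong₂ _+_
    (trans (length-cartesianProduct (paireds t) (outs s)) (cong₂ _*_ (length-paireds t) (length-outs s)))
    (trans (length-cartesianProduct (isolateds t) (isolateds s))
           (cong₂ _*_ (length-isolateds t) (length-isolateds s))))

  dissociations-sound : ∀ t {χ} → χ ∈ dissociations t → Diss t χ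
  outs-sound          : ∀ t {χ} → χ ∈ outs t → RootOut t χ
  isolateds-sound     : ∀ t {χ} → χ ∈ isolateds t → RootIsolated t χ
  paireds-sound       : ∀ t {χ} → χ ∈ paireds t → RootPaired t χ
  dissociations-sound t χ∈ with ∈-++⁻ (outs t) χ∈
  ... | inj₁ χ∈ = proj₁ (outs-sound t χ∈)
  ... | inj₂ χ∈ with ∈-++⁻ (isolateds t) χ∈
  ...   | inj₁ χ∈ = proj₁ (isolateds-sound t χ∈)
  ...   | inj₂ χ∈ = proj₁ (paireds-sound t χ∈)
  outs-sound leaf (here refl) = (λ _ ()) , refl
  outs-sound (join t s) χ∈ =
    let χ₁∈ , χ₂∈ = ∈-cartesianProduct⁻ (outs t) (dissociations s) χ∈
        d , r∉ = outs-sound t χ₁∈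
    in Diss-join⁺ t s d (dissociations-sound s χ₂∈) (λ r∈ → contradiction r∉ (true≢false r∈)) , r∉
  isolateds-sound leaf (here refl) = (λ _ _ _ _ ()) , refl , λ ()
  isolateds-sound (join t s) χ∈ =
    let χ₁∈ , χ₂∈ = ∈-cartesianProduct⁻ (isolateds t) (outs s) χ∈
        d , r∈ , isolated = isolateds-sound t χ₁∈
        d′ , r′∉ = outs-sound s χ₂∈
    in Diss-join⁺ t s d d′ (λ _ r′∈ → contradiction r′∉ (true≢false r′∈)) , r∈ ,
       λ { {inj₁ _} e → isolated e ; {inj₂ _} (_ , refl) → r′∉ }
  paireds-sound (join t s) χ∈ with ∈-++⁻ (cartesianProduct (paireds t) (outs s)) χ∈
  ... | inj₁ χ∈ =
    let χ₁∈ , χ₂∈ = ∈-cartesianProduct⁻ (paireds t) (outs s) χ∈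
        d , r∈ , v , e , v∈ = paireds-sound t χ₁∈
        d′ , r′∉ = outs-sound s χ₂∈
    in Diss-join⁺ t s d d′ (λ _ r′∈ → contradiction r′∉ (true≢false r′∈)) , r∈ , inj₁ v , e , v∈
  ... | inj₂ χ∈ =
    let χ₁∈ , χ₂∈ = ∈-cartesianProduct⁻ (isolateds t) (isolateds s) χ∈
        d , r∈ , isolated = isolateds-sound t χ₁∈
        d′ , r′∈ , isolated′ = isolateds-sound s χ₂∈
    in Diss-join⁺ t s d d′ (λ _ _ → isolated , isolated′) , r∈ , inj₂ (root s) , (refl , refl) , r′∈

  dissociations-complete : ∀ t {χ} → Diss t χ → χ ∈ dissociations t
  outs-complete          : ∀ t {χ} → RootOut t χ → χ ∈ outs t
  isolateds-complete     : ∀ t {χ} → RootIsolated t χ → χ ∈ isolateds t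
  paireds-complete       : ∀ t {χ} → RootPaired t χ → χ ∈ paireds t
  dissociations-complete t {χ} diss with classify t χ diss
  ... | inj₁ out             = ∈-++⁺ˡ (outs-complete t out)
  ... | inj₂ (inj₁ isolated) = ∈-++⁺ʳ (outs t) (∈-++⁺ˡ (isolateds-complete t isolated))
  ... | inj₂ (inj₂ paired)   = ∈-++⁺ʳ (outs t) (∈-++⁺ʳ (isolateds t) (paireds-complete t paired))
  outs-complete leaf (_ , refl) = here refl
  outs-complete (join t s) (diss , r∉) = ∈-cartesianProduct⁺
    (outs-complete t (Diss-join⁻ˡ t s diss , r∉)) (dissociations-complete s (Diss-join⁻ʳ t s diss))
  isolateds-complete leaf (_ , refl , _) = here refl
  isolateds-complete (join t s) (diss , r∈ , isolated) = ∈-cartesianProduct⁺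
    (isolateds-complete t (Diss-join⁻ˡ t s diss , r∈ , λ {v} → isolated {inj₁ v}))
    (outs-complete s (Diss-join⁻ʳ t s diss , isolated {inj₂ (root s)} (refl , refl)))
  paireds-complete (join t s) {χ , χ′} (diss , r∈ , inj₁ v , e , v∈) with member s χ′ (root s) in r′
  ... | true  = contradiction (proj₁ (Diss-join⁻ t s diss r∈ r′) e) (true≢false v∈)
  ... | false = ∈-++⁺ˡ (∈-cartesianProduct⁺
    (paireds-complete t (Diss-join⁻ˡ t s diss , r∈ , v , e , v∈))
    (outs-complete s (Diss-join⁻ʳ t s diss , r′)))
  paireds-complete (join t s) {χ , χ′} (diss , r∈ , inj₂ _ , (_ , refl) , r′∈) =
    let isolated , isolated′ = Diss-join⁻ t s diss r∈ r′∈ in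
    ∈-++⁺ʳ (cartesianProduct (paireds t) (outs s)) (∈-cartesianProduct⁺
      (isolateds-complete t (Diss-join⁻ˡ t s diss , r∈ , isolated))
      (isolateds-complete s (Diss-join⁻ʳ t s diss , r′∈ , isolated′)))

  -- Concatenated lists are disjoint because soundness assigns contradictory root statuses to a
  -- common member.
  dissociations-unique : ∀ t → Unique (dissociations t)
  outs-unique          : ∀ t → Unique (outs t)
  isolateds-unique     : ∀ t → Unique (isolateds t)
  paireds-unique       : ∀ t → Unique (paireds t)
  dissociations-unique t = Unique.++⁺ (outs-unique t)
    (Unique.++⁺ (isolateds-unique t) (paireds-unique t) isolated-paired) out-in
    where
    isolated-paired : Disjoint (isolateds t) (paireds t)
    isolated-paired (χ∈ , χ∈′) =
      let _ , _ , isolated = isolateds-sound t χ∈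
          _ , _ , v , e , v∈ = paireds-sound t χ∈′
      in true≢false v∈ (isolated e)
    out-in : Disjoint (outs t) (isolateds t ++ paireds t)
    out-in (χ∈ , χ∈′) with ∈-++⁻ (isolateds t) χ∈′
    ... | inj₁ χ∈′ = true≢false (proj₁ (proj₂ (isolateds-sound t χ∈′))) (proj₂ (outs-sound t χ∈))
    ... | inj₂ χ∈′ = true≢false (proj₁ (proj₂ (paireds-sound t χ∈′))) (proj₂ (outs-sound t χ∈))
  outs-unique leaf            = All.[] ∷ []
  outs-unique (join t s)      = Unique.cartesianProduct⁺ (outs-unique t) (dissociations-unique s)
  isolateds-unique leaf       = All.[] ∷ []
  isolateds-unique (join t s) = Unique.cartesianProduct⁺ (isolateds-unique t) (outs-unique s)
  paireds-unique leaf         = []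
  paireds-unique (join t s)   = Unique.++⁺
    (Unique.cartesianProduct⁺ (paireds-unique t) (outs-unique s))
    (Unique.cartesianProduct⁺ (isolateds-unique t) (isolateds-unique s))
    λ (χ∈ , χ∈′) →
      let _ , r′∉ = outs-sound s (proj₂ (∈-cartesianProduct⁻ (paireds t) (outs s) χ∈))
          _ , r′∈ , _ = isolateds-sound s (proj₂ (∈-cartesianProduct⁻ (isolateds t) (isolateds s) χ∈′))
      in true≢false r′∈ r′∉

  -- Restriction and extension along the isomorphism are injections in opposite directions between
  -- two lists without repetition, so the lengths agree.
  d≡σ : ∀ {n} (G : Graph (Fin n)) t → G ≅ graph t → d G ≡ σ t
  d≡σ {n} G t G≅t = trans (≤-antisym d≤ ≤d) (length-dissociations t)
    where
    open _≅_ G≅t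
    restrict : Subset n → VertexSet t
    restrict D = comprehend t (lookup D ∘ from)
    extend : VertexSet t → Subset n
    extend χ = tabulate (member t χ ∘ to)
    lookup-extend : ∀ χ → member t χ ∘ to ≗ lookup (extend χ)
    lookup-extend χ i = sym (lookup∘tabulate _ i)
    member-restrict : ∀ D → lookup D ∘ from ≗ member t (restrict D)
    member-restrict D v = sym (member-comprehend t _ v)
    restrict-injective : ∀ {D D′} → restrict D ≡ restrict D′ → D ≡ D′
    restrict-injective {D} {D′} eq = 
      trans (sym (tabulate∘lookup D)) (trans (tabulate-cong pointwise) (tabulate∘lookup D′))
      where
      pointwise : lookup D ≗ lookup D′
      pointwise i = subst (λ j → lookup D j ≡ lookup D′ j) (strictlyInverseʳ bijection i)
        (trans (member-restrict D (to i))
               (trans (cong (λ χ → member t χ (to i)) eq) (sym (member-restrict D′ (to i)))))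
    extend-injective : ∀ {χ χ′} → extend χ ≡ extend χ′ → χ ≡ χ′
    extend-injective {χ} {χ′} eq = member-injective t λ v →
      subst (λ w → member t χ w ≡ member t χ′ w) (strictlyInverseˡ bijection v)
        (trans (lookup-extend χ (from v))
               (trans (cong (λ D → lookup D (from v)) eq) (sym (lookup-extend χ′ (from v)))))
    d≤ : d G ≤ length (dissociations t)
    d≤ = Unique-injection⇒length≤ restrict restrict-injective
      (Unique.filter⁺ (isDissociation? G) (subsets-unique n))
      λ {D} D∈ → dissociations-complete t (Dissociation-cong (graph t) (member-restrict D)
        (Dissociation-resp-≅ (≅-sym G≅t) (IsDissociation⇒Dissociation G
          (proj₂ (∈-filter⁻ (isDissociation? G) {xs = subsets n} D∈)))))
    ≤d : length (dissociations t) ≤ d G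
    ≤d = Unique-injection⇒length≤ extend extend-injective (dissociations-unique t)
      λ {χ} χ∈ → ∈-filter⁺ (isDissociation? G) (subsets-complete (extend χ))
        (Dissociation⇒IsDissociation G (Dissociation-cong G (lookup-extend χ)
          (Dissociation-resp-≅ G≅t (dissociations-sound t χ∈))))

open Counting

-- Every finite tree is the graph of some `Tree`.

module Representation where

  open import Data.Empty using (⊥)
  open import Data.Nat.Base using (ℕ; zero; suc; _+_; _≤_)
  open import Data.Nat.Properties
  open import Data.Fin.Base using (Fin; zero; suc; inject₁; fromℕ)
  import Data.Fin.Properties as Fin
  open import Data.List.Base as List using (List; []; _∷_; _++_; map; length)
  open import Data.List.Membership.Propositional using (_∈_)
  open import Data.List.Membership.Propositional.Properties using (∈-map⁻)
  open import Data.List.Relation.Unary.All as All using (All)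
  import Data.List.Relation.Unary.All.Properties as All
  open import Data.List.Relation.Unary.AllPairs using ([]; _∷_)
  open import Data.List.Relation.Unary.Unique.Propositional using (Unique)
  open import Data.List.Relation.Unary.Unique.Propositional.Properties as Unique using ()
  open import Data.Product.Base using (_×_; _,_; proj₁; proj₂; ∃; ∃-syntax)
  open import Data.Sum.Base using (_⊎_; inj₁; inj₂)
  open import Data.Sum.Function.Propositional using (_⊎-↔_)
  open import Data.Sum.Properties using (inj₁-injective; inj₂-injective)
  open import Data.Unit.Base using (⊤; tt)
  open import Function.Base using (id; _∘_)
  open import Function.Bundles using (_↔_; Inverse; mk↔ₛ′)
  open import Function.Properties.Inverse using (↔-sym; ↔-trans)
  open import Relation.Binary.Construct.Closure.ReflexiveTransitive using (Star; ε; _◅_)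
  open import Relation.Binary.PropositionalEquality
    using (_≡_; _≢_; refl; sym; trans; cong; subst; subst₂)
  open import Relation.Nullary.Decidable using (Dec; yes; no; map′)
  open import Relation.Nullary.Negation using (¬_; contradiction)
  import Relation.Unary as U
  open Inverse using (strictlyInverseˡ; strictlyInverseʳ)

  insert : ∀ t → Vertex t → Tree
  insert leaf       _        = P₂
  insert (join t s) (inj₁ x) = join (insert t x) s
  insert (join t s) (inj₂ x) = join t (insert s x)

  edges-insert : ∀ t x → edges (insert t x) ≡ suc (edges t)
  edges-insert leaf       _        = refl
  edges-insert (join t s) (inj₁ x) = cong (λ k → suc (k + edges s)) (edges-insert t x)
  edges-insert (join t s) (inj₂ x) = cong suc (trans (cong (edges t +_) (edges-insert s x)) (+-suc (edges t) (edges s)))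

  hang : ∀ t → Vertex t → Graph (Vertex t ⊎ Fin 1)
  hang t x = Attach.attach _≟ⱽ_ (graph t) x (complete 1) {R = λ _ → ⊤} (λ _ → yes tt)

  -- An outer `join` places its edge at the roots of its parts, so the induction must know that
  -- roots correspond.
  record Insertion (t : Tree) (x : Vertex t) : Set where
    field
      iso   : graph (insert t x) ≅ hang t x
      root≡ : _≅_.to iso (root (insert t x)) ≡ inj₁ (root t)

    open _≅_ iso public using (to; from; bijection)

    from-root : from (inj₁ (root t)) ≡ root (insert t x)
    from-root = trans (cong from (sym root≡)) (strictlyInverseʳ bijection (root (insert t x)))

  insertion : ∀ t x → Insertion t x
  insertion leaf _ = record { iso = mk≅ (mk↔ₛ′ to from to-from from-to) to-hom′ from-hom′ ; root≡ = refl }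
    where
    to : Vertex P₂ → ⊤ ⊎ Fin 1
    to (inj₁ _) = inj₁ tt
    to (inj₂ _) = inj₂ zero
    from : ⊤ ⊎ Fin 1 → Vertex P₂
    from (inj₁ _) = inj₁ tt
    from (inj₂ _) = inj₂ tt
    to-from : ∀ v → to (from v) ≡ v
    to-from (inj₁ tt)   = refl
    to-from (inj₂ zero) = refl
    from-to : ∀ v → from (to v) ≡ v
    from-to (inj₁ tt) = refl
    from-to (inj₂ tt) = refl
    to-hom′ : Hom (graph P₂) (hang leaf tt) to
    to-hom′ (inj₁ _) (inj₂ _) _ = refl , tt
    to-hom′ (inj₂ _) (inj₁ _) _ = refl , tt
    from-hom′ : Hom (hang leaf tt) (graph P₂) from
    from-hom′ (inj₁ _) (inj₂ _) _ = refl , refl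
    from-hom′ (inj₂ _) (inj₁ _) _ = refl , refl
    from-hom′ (inj₂ zero) (inj₂ zero) e = contradiction refl e
  insertion (join t s) (inj₁ x) = record
    { iso = mk≅ (mk↔ₛ′ to′ from′ to-from from-to) to-hom′ from-hom′
    ; root≡ = cong place root≡ }
    where
    open Insertion (insertion t x)
    place : Vertex t ⊎ Fin 1 → Vertex (join t s) ⊎ Fin 1
    place (inj₁ v) = inj₁ (inj₁ v)
    place (inj₂ k) = inj₂ k
    to′ : Vertex (join (insert t x) s) → Vertex (join t s) ⊎ Fin 1
    to′ (inj₁ v) = place (to v)
    to′ (inj₂ w) = inj₁ (inj₂ w)
    from′ : Vertex (join t s) ⊎ Fin 1 → Vertex (join (insert t x) s)
    from′ (inj₁ (inj₁ v)) = inj₁ (from (inj₁ v))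
    from′ (inj₁ (inj₂ w)) = inj₂ w
    from′ (inj₂ k)        = inj₁ (from (inj₂ k))
    to-from : ∀ v → to′ (from′ v) ≡ v
    to-from (inj₁ (inj₁ v)) = cong place (strictlyInverseˡ bijection (inj₁ v))
    to-from (inj₁ (inj₂ w)) = refl
    to-from (inj₂ k)        = cong place (strictlyInverseˡ bijection (inj₂ k))
    from-place : ∀ v → from′ (place v) ≡ inj₁ (from v)
    from-place (inj₁ _) = refl
    from-place (inj₂ _) = refl
    from-to : ∀ v → from′ (to′ v) ≡ v
    from-to (inj₁ v) = trans (from-place (to v)) (cong inj₁ (strictlyInverseʳ bijection v))
    from-to (inj₂ w) = refl
    place-hom : Hom (hang t x) (hang (join t s) (inj₁ x)) place
    place-hom (inj₁ _) (inj₁ _) e = e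
    place-hom (inj₁ _) (inj₂ _) (refl , _) = refl , tt
    place-hom (inj₂ _) (inj₁ _) (refl , _) = refl , tt
    place-hom (inj₂ _) (inj₂ _) e = e
    to-hom′ : Hom (graph (join (insert t x) s)) (hang (join t s) (inj₁ x)) to′
    to-hom′ (inj₁ v) (inj₁ w) e = place-hom (to v) (to w) (to-hom iso v w e)
    to-hom′ (inj₁ v) (inj₂ w) (refl , refl) rewrite root≡ = refl , refl
    to-hom′ (inj₂ v) (inj₁ w) (refl , refl) rewrite root≡ = refl , refl
    to-hom′ (inj₂ v) (inj₂ w) e = e
    from-hom′ : Hom (hang (join t s) (inj₁ x)) (graph (join (insert t x) s)) from′
    from-hom′ (inj₁ (inj₁ v)) (inj₁ (inj₁ w)) e = from-hom iso (inj₁ v) (inj₁ w) e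
    from-hom′ (inj₁ (inj₁ v)) (inj₁ (inj₂ w)) (refl , refl) = from-root , refl
    from-hom′ (inj₁ (inj₂ v)) (inj₁ (inj₁ w)) (refl , refl) = from-root , refl
    from-hom′ (inj₁ (inj₂ v)) (inj₁ (inj₂ w)) e = e
    from-hom′ (inj₁ (inj₁ v)) (inj₂ k) (refl , _) = from-hom iso (inj₁ x) (inj₂ k) (refl , tt)
    from-hom′ (inj₂ k) (inj₁ (inj₁ w)) (refl , _) = from-hom iso (inj₂ k) (inj₁ x) (refl , tt)
    from-hom′ (inj₂ k) (inj₂ l) e = from-hom iso (inj₂ k) (inj₂ l) e
  insertion (join t s) (inj₂ x) = record
    { iso = mk≅ (mk↔ₛ′ to′ from′ to-from from-to) to-hom′ from-hom′
    ; root≡ = refl }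
    where
    open Insertion (insertion s x)
    place : Vertex s ⊎ Fin 1 → Vertex (join t s) ⊎ Fin 1
    place (inj₁ v) = inj₁ (inj₂ v)
    place (inj₂ k) = inj₂ k
    to′ : Vertex (join t (insert s x)) → Vertex (join t s) ⊎ Fin 1
    to′ (inj₁ v) = inj₁ (inj₁ v)
    to′ (inj₂ w) = place (to w)
    from′ : Vertex (join t s) ⊎ Fin 1 → Vertex (join t (insert s x))
    from′ (inj₁ (inj₁ v)) = inj₁ v
    from′ (inj₁ (inj₂ w)) = inj₂ (from (inj₁ w))
    from′ (inj₂ k)        = inj₂ (from (inj₂ k))
    to-from : ∀ v → to′ (from′ v) ≡ v
    to-from (inj₁ (inj₁ v)) = refl
    to-from (inj₁ (inj₂ w)) = cong place (strictlyInverseˡ bijection (inj₁ w))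
    to-from (inj₂ k)        = cong place (strictlyInverseˡ bijection (inj₂ k))
    from-place : ∀ v → from′ (place v) ≡ inj₂ (from v)
    from-place (inj₁ _) = refl
    from-place (inj₂ _) = refl
    from-to : ∀ v → from′ (to′ v) ≡ v
    from-to (inj₁ v) = refl
    from-to (inj₂ w) = trans (from-place (to w)) (cong inj₂ (strictlyInverseʳ bijection w))
    place-hom : Hom (hang s x) (hang (join t s) (inj₂ x)) place
    place-hom (inj₁ _) (inj₁ _) e = e
    place-hom (inj₁ _) (inj₂ _) (refl , _) = refl , tt
    place-hom (inj₂ _) (inj₁ _) (refl , _) = refl , tt
    place-hom (inj₂ _) (inj₂ _) e = e
    to-hom′ : Hom (graph (join t (insert s x))) (hang (join t s) (inj₂ x)) to′
    to-hom′ (inj₁ v) (inj₁ w) e = e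
    to-hom′ (inj₁ v) (inj₂ w) (refl , refl) rewrite root≡ = refl , refl
    to-hom′ (inj₂ v) (inj₁ w) (refl , refl) rewrite root≡ = refl , refl
    to-hom′ (inj₂ v) (inj₂ w) e = place-hom (to v) (to w) (to-hom iso v w e)
    from-hom′ : Hom (hang (join t s) (inj₂ x)) (graph (join t (insert s x))) from′
    from-hom′ (inj₁ (inj₁ v)) (inj₁ (inj₁ w)) e = e
    from-hom′ (inj₁ (inj₁ v)) (inj₁ (inj₂ w)) (refl , refl) = refl , from-root
    from-hom′ (inj₁ (inj₂ v)) (inj₁ (inj₁ w)) (refl , refl) = refl , from-root
    from-hom′ (inj₁ (inj₂ v)) (inj₁ (inj₂ w)) e = from-hom iso (inj₁ v) (inj₁ w) e
    from-hom′ (inj₁ (inj₂ v)) (inj₂ k) (refl , _) = from-hom iso (inj₁ x) (inj₂ k) (refl , tt)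
    from-hom′ (inj₂ k) (inj₁ (inj₂ w)) (refl , _) = from-hom iso (inj₂ k) (inj₁ x) (refl , tt)
    from-hom′ (inj₂ k) (inj₂ l) e = from-hom iso (inj₂ k) (inj₂ l) e

  data Route {V : Set} (_~_ : V → V → Set) : V → V → List V → Set where
    [_] : ∀ x → Route _~_ x x (x ∷ [])
    _∷_ : ∀ {x y z vs} → x ~ y → Route _~_ y z vs → Route _~_ x z (x ∷ vs)

  module _ {V : Set} {_~_ : V → V → Set} where
    _++[_]_ : ∀ {x y y′ z vs ws} → Route _~_ x y vs → y ~ y′ → Route _~_ y′ z ws → Route _~_ x z (vs ++ ws)
    [ _ ]   ++[ e ] r′ = e ∷ r′
    (f ∷ r) ++[ e ] r′ = f ∷ (r ++[ e ] r′)

    Route-step : ∀ {x z v vs} → Route _~_ x z (v ∷ vs) → ∀ (i : Fin (length vs)) →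
                 List.lookup (v ∷ vs) (inject₁ i) ~ List.lookup vs i
    Route-step (e ∷ [ _ ])    zero    = e
    Route-step (e ∷ (_ ∷ _))  zero    = e
    Route-step (e ∷ (f ∷ r))  (suc i) = Route-step (f ∷ r) i

    Route-end : ∀ {x z v vs} → Route _~_ x z (v ∷ vs) → List.lookup (v ∷ vs) (fromℕ (length vs)) ≡ z
    Route-end [ _ ]         = refl
    Route-end (_ ∷ [ _ ])   = refl
    Route-end (_ ∷ (e ∷ r)) = Route-end (e ∷ r)

  Route-map : {V W : Set} {_~_ : V → V → Set} {_~′_ : W → W → Set} (φ : V → W) →
              (∀ {v w} → v ~ w → φ v ~′ φ w) → ∀ {x z vs} → Route _~_ x z vs → Route _~′_ (φ x) (φ z) (map φ vs)
  Route-map φ hom [ x ]   = [ φ x ]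
  Route-map φ hom (e ∷ r) = hom e ∷ Route-map φ hom r

  -- A route between the two sides crosses the joining edge once; its halves lie in different
  -- summands and so share no vertex.
  simple-route : ∀ t x z → ∃[ vs ] Route (Graph._~_ (graph t)) x z vs × Unique vs
  simple-route leaf tt tt = tt ∷ [] , [ tt ] , All.[] ∷ []
  simple-route (join t s) (inj₁ x) (inj₁ z) =
    let vs , r , u = simple-route t x z in map inj₁ vs , Route-map inj₁ id r , Unique.map⁺ inj₁-injective u
  simple-route (join t s) (inj₂ x) (inj₂ z) =
    let vs , r , u = simple-route s x z in map inj₂ vs , Route-map inj₂ id r , Unique.map⁺ inj₂-injective u
  simple-route (join t s) (inj₁ x) (inj₂ z) =
    let vs , r , u = simple-route t x (root t)
        ws , q , v = simple-route s (root s) z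
    in map inj₁ vs ++ map inj₂ ws ,
       Route-map inj₁ id r ++[ refl , refl ] Route-map inj₂ id q ,
       Unique.++⁺ (Unique.map⁺ inj₁-injective u) (Unique.map⁺ inj₂-injective v)
         λ (∈₁ , ∈₂) → inj₁≢inj₂ (∈-map⁻ inj₁ ∈₁) (∈-map⁻ inj₂ ∈₂)
    where
    inj₁≢inj₂ : ∀ {A B : Set} {vs : List A} {ws : List B} {x : A ⊎ B} →
                (∃[ v ] v ∈ vs × x ≡ inj₁ v) → (∃[ w ] w ∈ ws × x ≡ inj₂ w) → ⊥
    inj₁≢inj₂ (_ , _ , refl) (_ , _ , ())
  simple-route (join t s) (inj₂ x) (inj₁ z) =
    let vs , r , u = simple-route s x (root s)
        ws , q , v = simple-route t (root t) z
    in map inj₂ vs ++ map inj₁ ws ,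
       Route-map inj₂ id r ++[ refl , refl ] Route-map inj₁ id q ,
       Unique.++⁺ (Unique.map⁺ inj₂-injective u) (Unique.map⁺ inj₁-injective v)
         λ (∈₁ , ∈₂) → inj₂≢inj₁ (∈-map⁻ inj₂ ∈₁) (∈-map⁻ inj₁ ∈₂)
    where
    inj₂≢inj₁ : ∀ {A B : Set} {vs : List A} {ws : List B} {x : B ⊎ A} →
                (∃[ v ] v ∈ vs × x ≡ inj₂ v) → (∃[ w ] w ∈ ws × x ≡ inj₁ w) → ⊥
    inj₂≢inj₁ (_ , _ , refl) (_ , _ , ())

  -- Distinct ends give the route at least two vertices and `y` is a third, the minimum for `Cycle`,
  -- whose `k` counts the vertices beyond three.
  close-route : {V : Set} (G : Graph V) → let open Graph G in ∀ {x z y vs} →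
                Route _~_ x z vs → Unique vs → x ≢ z → All (y ≢_) vs → y ~ x → z ~ y → Cycle G
  close-route G {x} {z} {y} route unique x≢z y∉ y~x z~y = by-length route unique x≢z y∉
    where
    open Graph G
    cycle : ∀ {v w vs} → Route _~_ x z (v ∷ w ∷ vs) → Unique (v ∷ w ∷ vs) → All (y ≢_) (v ∷ w ∷ vs) → Cycle G
    cycle {v} {w} {vs} r u y∉ = record
      { k        = length vs
      ; c        = List.lookup (y ∷ v ∷ w ∷ vs)
      ; distinct = Unique⇒lookup-injective (y∉ ∷ u)
      ; step     = Route-step (y~x ∷ r)
      ; close    = subst (_~ y) (sym (Route-end (y~x ∷ r))) z~y }
    by-length : ∀ {vs} → Route _~_ x z vs → Unique vs → x ≢ z → All (y ≢_) vs → Cycle G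
    by-length [ _ ]           _ x≢x _  = contradiction refl x≢x
    by-length r@(_ ∷ [ _ ])   u _   y∉ = cycle r u y∉
    by-length r@(_ ∷ (_ ∷ _)) u _   y∉ = cycle r u y∉

  search : ∀ t {P : Vertex t → Set} → U.Decidable P → Dec (∃ P)
  search leaf P? = map′ (tt ,_) proj₂ (P? tt)
  search (join t s) P? with search t (P? ∘ inj₁) | search s (P? ∘ inj₂)
  ... | yes (v , p) | _           = yes (inj₁ v , p)
  ... | no _        | yes (v , p) = yes (inj₂ v , p)
  ... | no ¬p       | no ¬q       = no λ { (inj₁ v , p) → ¬p (v , p) ; (inj₂ v , p) → ¬q (v , p) }

  Vertex↔Fin : ∀ t → Vertex t ↔ Fin (suc (edges t))
  Vertex↔Fin leaf = mk↔ₛ′ (λ _ → zero) (λ _ → tt) (λ { zero → refl }) (λ _ → refl)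
  Vertex↔Fin (join t s) = subst (λ k → Vertex (join t s) ↔ Fin (suc k)) (+-suc (edges t) (edges s))
    (↔-trans (Vertex↔Fin t ⊎-↔ Vertex↔Fin s) (↔-sym Fin.+↔⊎))

  -- An embedding as an induced subgraph: `reflects` turns an embedding that covers all vertices
  -- into an isomorphism.
  record Embedding {V W : Set} (G : Graph V) (H : Graph W) : Set where
    field
      embed     : V → W
      injective : ∀ {v w} → embed v ≡ embed w → v ≡ w
      preserves : Hom G H embed
      reflects  : ∀ v w → Graph._~_ H (embed v) (embed w) → Graph._~_ G v w

  -- Applied to a walk from an embedded vertex to a missing one, it supplies the next leaf to add;
  -- connectedness enters here.
  frontier : {V : Set} {_~_ : V → V → Set} {P : V → Set} → U.Decidable P → ∀ {v w} →
             Star _~_ v w → P v → ¬ P w → ∃[ x ] ∃[ y ] x ~ y × P x × ¬ P y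
  frontier P? ε p ¬p = contradiction p ¬p
  frontier P? (_◅_ {j = y} e es) p ¬p with P? y
  ... | yes q = frontier P? es q ¬p
  ... | no ¬q = _ , y , e , p , ¬q

  module _ {n : ℕ} {G : Graph (Fin n)} (isTree : IsTree G) where
    open Graph G
    open IsTree isTree

    Covered : ∀ {t} → Embedding (graph t) G → Fin n → Set
    Covered E w = ∃[ v ] Embedding.embed E v ≡ w

    covered? : ∀ {t} (E : Embedding (graph t) G) → U.Decidable (Covered E)
    covered? {t} E w = search t (λ v → Embedding.embed E v Fin.≟ w)

    order≤ : ∀ {t} → Embedding (graph t) G → suc (edges t) ≤ n
    order≤ {t} E = Fin.injective⇒≤ {f = embed ∘ from} λ eq →
      trans (sym (strictlyInverseˡ (Vertex↔Fin t) _))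
            (trans (cong to (injective eq)) (strictlyInverseˡ (Vertex↔Fin t) _))
      where
      open Embedding E
      open Inverse (Vertex↔Fin t) using (to; from)

    covering⇒≅ : ∀ {t} (E : Embedding (graph t) G) → (∀ w → Covered E w) → G ≅ graph t
    covering⇒≅ E covers = ≅-sym (mk≅
      (mk↔ₛ′ embed (proj₁ ∘ covers) (proj₂ ∘ covers) (λ v → injective (proj₂ (covers (embed v)))))
      preserves
      λ v w e → reflects _ _ (subst₂ _~_ (sym (proj₂ (covers v))) (sym (proj₂ (covers w))) e))
      where open Embedding E

    -- Two neighbours of y in the embedded tree would close a cycle through y.
    unique-neighbour : ∀ {t} (E : Embedding (graph t) G) {y} → ¬ Covered E y → ∀ {x z} →
                       y ~ Embedding.embed E x → y ~ Embedding.embed E z → x ≡ z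
    unique-neighbour {t} E {y} ¬covered {x} {z} y~x y~z with x ≟ⱽ z
    ... | yes x≡z = x≡z
    ... | no  x≢z =
      let vs , r , u = simple-route t x z in
      contradiction
        (close-route G (Route-map embed (preserves _ _) r) (Unique.map⁺ injective u) (x≢z ∘ injective)
          (All.map⁺ (All.universal (λ v y≡ → ¬covered (v , sym y≡)) vs)) y~x (~-sym y~z))
        acyclic
      where open Embedding E

    extend : ∀ {t} (E : Embedding (graph t) G) {x y} → Embedding.embed E x ~ y → ¬ Covered E y →
             Embedding (graph (insert t x)) G
    extend {t} E {x} {y} x~y ¬covered = record
      { embed     = φ ∘ to
      ; injective = λ {v} {w} eq →
          trans (sym (strictlyInverseʳ bijection v))
                (trans (cong from (φ-injective (to v) (to w) eq)) (strictlyInverseʳ bijection w))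
      ; preserves = λ v w e → φ-preserves (to v) (to w) (to-hom iso v w e)
      ; reflects  = λ v w e → subst₂ (Graph._~_ (graph (insert t x)))
          (strictlyInverseʳ bijection v) (strictlyInverseʳ bijection w)
          (from-hom iso _ _ (φ-reflects (to v) (to w) e)) }
      where
      open Embedding E
      open Insertion (insertion t x)
      φ : Vertex t ⊎ Fin 1 → Fin n
      φ (inj₁ v) = embed v
      φ (inj₂ _) = y
      φ-injective : ∀ v w → φ v ≡ φ w → v ≡ w
      φ-injective (inj₁ v) (inj₁ w) eq = cong inj₁ (injective eq)
      φ-injective (inj₁ v) (inj₂ _) eq = contradiction (v , eq) ¬covered
      φ-injective (inj₂ _) (inj₁ w) eq = contradiction (w , sym eq) ¬covered
      φ-injective (inj₂ zero) (inj₂ zero) _ = refl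
      φ-preserves : Hom (hang t x) G φ
      φ-preserves (inj₁ v) (inj₁ w) e = preserves v w e
      φ-preserves (inj₁ v) (inj₂ _) (refl , _) = x~y
      φ-preserves (inj₂ _) (inj₁ w) (refl , _) = ~-sym x~y
      φ-preserves (inj₂ zero) (inj₂ zero) e = contradiction refl e
      φ-reflects : ∀ v w → φ v ~ φ w → Graph._~_ (hang t x) v w
      φ-reflects (inj₁ v) (inj₁ w) e = reflects v w e
      -- Acyclicity enters here: the new vertex has no embedded neighbour other than the image of
      -- `x`.
      φ-reflects (inj₁ v) (inj₂ _) e = unique-neighbour E ¬covered (~-sym e) (~-sym x~y) , tt
      φ-reflects (inj₂ _) (inj₁ w) e = unique-neighbour E ¬covered e (~-sym x~y) , tt
      φ-reflects (inj₂ _) (inj₂ _) e = contradiction e ~-irrefl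

    -- The embedded tree grows leaf by leaf. Each leaf trades one unit of `fuel` for an edge, and
    -- with no fuel left the tree would have more vertices than `G`.
    complete-embedding : ∀ fuel {t} → Embedding (graph t) G → n ≤ edges t + fuel → ∃[ u ] G ≅ graph u
    complete-embedding zero {t} E n≤ =
      contradiction (≤-trans (order≤ E) (subst (n ≤_) (+-identityʳ (edges t)) n≤)) 1+n≰n
    complete-embedding (suc fuel) {t} E n≤ with Fin.all? (covered? E)
    ... | yes covers = t , covering⇒≅ E covers
    ... | no ¬covers with Fin.¬∀⟶∃¬ n _ (covered? E) ¬covers
    ...   | w , ¬w with frontier (covered? E) (connected (Embedding.embed E (root t)) w) (root t , refl) ¬w
    ...     | _ , y , e , (x , refl) , ¬y = complete-embedding fuel (extend E e ¬y)
              (subst (n ≤_) (trans (+-suc (edges t) fuel) (cong (_+ fuel) (sym (edges-insert t x)))) n≤)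

  tree-representation : ∀ {n} {G : Graph (Fin (suc n))} → IsTree G → ∃[ t ] G ≅ graph t
  tree-representation {n} {G} isTree = complete-embedding isTree (suc n) single ≤-refl
    where
    single : Embedding (graph leaf) G
    single = record
      { embed     = λ _ → zero
      ; injective = λ _ → refl
      ; preserves = λ _ _ ()
      ; reflects  = λ _ _ e → Graph.~-irrefl G e }

open Representation

-- The maximum in closed form.

module ClosedForm where

  open import Data.Nat.Base using (ℕ; zero; suc; _+_; _*_; _^_)
  import Data.Nat.Base as ℕ
  open import Data.Nat.Divisibility using (_∣_; divides; _∣?_)
  open import Data.Nat.DivMod using (m*n/n≡m)
  open import Data.Nat.Properties
  open import Data.Nat.Tactic.RingSolver using (solve-∀)
  open import Data.Integer.Base as ℤ using (ℤ; +_)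
  import Data.Integer.Properties as ℤ
  open import Data.Rational.Base as ℚ using (ℚ; toℚᵘ; _≤_)
  import Data.Rational.Properties as ℚ
  open import Data.Rational.Unnormalised.Base as ℚᵘ using (ℚᵘ; mkℚᵘ; *≡*; *≤*)
  import Data.Rational.Unnormalised.Properties as ℚᵘ
  open import Data.Bool.Base using (if_then_else_)
  open import Data.Fin.Base using (zero; suc)
  open import Relation.Binary.PropositionalEquality using (_≡_; refl; sym; trans; cong; cong₂)
  open import Relation.Nullary.Decidable using (Dec; does; dec-true; dec-false)
  open import Relation.Nullary.Negation using (¬_)

  toℚᵘ-toℚ : ∀ m → toℚᵘ (toℚ m) ℚᵘ.≃ mkℚᵘ (+ m) 0
  toℚᵘ-toℚ m = ℚ.toℚᵘ-fromℚᵘ (mkℚᵘ (+ m) 0)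

  toℚ-homo-+ : ∀ m n → toℚ m ℚ.+ toℚ n ≡ toℚ (m + n)
  toℚ-homo-+ m n = ℚ.toℚᵘ-injective (begin
    toℚᵘ (toℚ m ℚ.+ toℚ n)            ≈⟨ ℚ.toℚᵘ-homo-+ (toℚ m) (toℚ n) ⟩
    toℚᵘ (toℚ m) ℚᵘ.+ toℚᵘ (toℚ n)    ≈⟨ ℚᵘ.+-cong (toℚᵘ-toℚ m) (toℚᵘ-toℚ n) ⟩
    mkℚᵘ (+ m) 0 ℚᵘ.+ mkℚᵘ (+ n) 0    ≈⟨ *≡* (cong (ℤ._* + 1) (cong₂ ℤ._+_ (ℤ.*-identityʳ (+ m)) (ℤ.*-identityʳ (+ n)))) ⟩
    mkℚᵘ (+ (m + n)) 0                ≈⟨ toℚᵘ-toℚ (m + n) ⟨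
    toℚᵘ (toℚ (m + n))                ∎)
    where open ℚᵘ.≃-Reasoning

  toℚ-homo-* : ∀ m n → toℚ m ℚ.* toℚ n ≡ toℚ (m * n)
  toℚ-homo-* m n = ℚ.toℚᵘ-injective (begin
    toℚᵘ (toℚ m ℚ.* toℚ n)            ≈⟨ ℚ.toℚᵘ-homo-* (toℚ m) (toℚ n) ⟩
    toℚᵘ (toℚ m) ℚᵘ.* toℚᵘ (toℚ n)    ≈⟨ ℚᵘ.*-cong (toℚᵘ-toℚ m) (toℚᵘ-toℚ n) ⟩
    mkℚᵘ (+ m) 0 ℚᵘ.* mkℚᵘ (+ n) 0    ≈⟨ *≡* (cong (ℤ._* + 1) (sym (ℤ.pos-* m n))) ⟩
    mkℚᵘ (+ (m * n)) 0                ≈⟨ toℚᵘ-toℚ (m * n) ⟨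
    toℚᵘ (toℚ (m * n))                ∎)
    where open ℚᵘ.≃-Reasoning

  toℚ-mono-≤ : ∀ {m n} → m ℕ.≤ n → toℚ m ≤ toℚ n
  toℚ-mono-≤ {m} {n} m≤n = ℚ.toℚᵘ-cancel-≤ (begin
    toℚᵘ (toℚ m)   ≃⟨ toℚᵘ-toℚ m ⟩
    mkℚᵘ (+ m) 0   ≤⟨ *≤* (ℤ.*-monoʳ-≤-nonNeg (+ 1) (ℤ.+≤+ m≤n)) ⟩
    mkℚᵘ (+ n) 0   ≃⟨ toℚᵘ-toℚ n ⟨
    toℚᵘ (toℚ n)   ∎)
    where open ℚᵘ.≤-Reasoning

  toℚ-injective : ∀ {m n} → toℚ m ≡ toℚ n → m ≡ n
  toℚ-injective {m} {n} eq = ℤ.+-injective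
    (trans (sym (ℤ.*-identityʳ (+ m))) (trans (ℚᵘ.drop-*≡* m≃n) (ℤ.*-identityʳ (+ n))))
    where
    m≃n : mkℚᵘ (+ m) 0 ℚᵘ.≃ mkℚᵘ (+ n) 0
    m≃n = ℚᵘ.≃-trans (ℚᵘ.≃-sym (toℚᵘ-toℚ m)) (ℚᵘ.≃-trans (ℚᵘ.≃-reflexive (cong toℚᵘ eq)) (toℚᵘ-toℚ n))

  2∤1+j*2 : ∀ j → ¬ 2 ∣ 1 + j * 2
  2∤1+j*2 zero    (divides (suc _) ())
  2∤1+j*2 (suc j) (divides (suc q) eq) = 2∤1+j*2 j (divides q (suc-injective (suc-injective eq)))

  h-even : ∀ j → h (j * 2) ≡ 2 ^ j
  h-even zero    = refl
  h-even (suc j) = cong (2 *_) (h-even j)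

  h-odd : ∀ j → h (1 + j * 2) ≡ 2 ^ j
  h-odd zero    = refl
  h-odd (suc j) = cong (2 *_) (h-odd j)

  -- The parity is that of the number of edges. The factor is n + 3 for the odd order n = 5 + 2j; in
  -- `ε-odd` it is n + 6 for n = 6 + 2j.
  ε-even : ∀ j → ε (4 + j * 2) ≡ (5 + j * 2 + 3) * 2 ^ j
  ε-even zero    = refl
  ε-even (suc j) = trans (cong₂ (λ e y → 2 * e + 2 * (2 * y)) (ε-even j) (h-even j)) (ring (j * 2) (2 ^ j))
    where
    ring : ∀ i x → 2 * ((5 + i + 3) * x) + 2 * (2 * x) ≡ (5 + (2 + i) + 3) * (2 * x)
    ring = solve-∀

  ε-odd : ∀ j → ε (5 + j * 2) ≡ (6 + j * 2 + 6) * 2 ^ j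
  ε-odd zero    = refl
  ε-odd (suc j) = trans (cong₂ (λ e y → 2 * e + 2 * (2 * y)) (ε-odd j) (h-odd j)) (ring (j * 2) (2 ^ j))
    where
    ring : ∀ i x → 2 * ((6 + i + 6) * x) + 2 * (2 * x) ≡ (6 + (2 + i) + 6) * (2 * x)
    ring = solve-∀

  data HalfView : ℕ → Set where
    2*   : ∀ j → HalfView (j * 2)
    1+2* : ∀ j → HalfView (1 + j * 2)

  halfView : ∀ n → HalfView n
  halfView zero = 2* 0
  halfView (suc n) with halfView n
  ... | 2* j   = 1+2* j
  ... | 1+2* j = 2* (suc j)

  if-yes : {A P : Set} (P? : Dec P) {x y : A} → P → (if does P? then x else y) ≡ x
  if-yes P? p rewrite dec-true P? p = refl

  if-no : {A P : Set} (P? : Dec P) {x y : A} → ¬ P → (if does P? then x else y) ≡ y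
  if-no P? ¬p rewrite dec-false P? ¬p = refl

  toℚ-homo-+* : ∀ a b c → toℚ a ℚ.+ toℚ b ℚ.* toℚ c ≡ toℚ (a + b * c)
  toℚ-homo-+* a b c = trans (cong (toℚ a ℚ.+_) (toℚ-homo-* b c)) (toℚ-homo-+ a (b * c))

  f-odd : ∀ n {a b} → ¬ 2 ∣ n → + n ℤ.- + 1 ≡ + a → (+ n ℤ.- + 5) ℤ./ℕ 2 ≡ + b →
          f n ≡ toℚ (2 ^ a + (n + 3) * 2 ^ b)
  f-odd n {a} {b} 2∤n a≡ b≡ = trans (if-no (2 ∣? n) 2∤n)
    (trans (cong₂ (λ i j → 2^ i ℚ.+ toℚ (n + 3) ℚ.* 2^ j) a≡ b≡) (toℚ-homo-+* (2 ^ a) (n + 3) (2 ^ b)))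

  f-even : ∀ n {a b} → 2 ∣ n → + n ℤ.- + 1 ≡ + a → (+ n ℤ.- + 6) ℤ./ℕ 2 ≡ + b →
           f n ≡ toℚ (2 ^ a + (n + 6) * 2 ^ b)
  f-even n {a} {b} 2∣n a≡ b≡ = trans (if-yes (2 ∣? n) 2∣n)
    (trans (cong₂ (λ i j → 2^ i ℚ.+ toℚ (n + 6) ℚ.* 2^ j) a≡ b≡) (toℚ-homo-+* (2 ^ a) (n + 6) (2 ^ b)))

  -- For orders 1 to 4 the second exponent of `f` is negative, and evaluation in the rationals
  -- decides; from order 5 on every exponent is a natural number.
  f≡bound : ∀ k → f (suc k) ≡ toℚ (bound k)
  f≡bound 0 = refl
  f≡bound 1 = refl
  f≡bound 2 = refl
  f≡bound 3 = refl
  f≡bound (suc (suc (suc (suc k)))) = by-parity (halfView k)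
    where
    by-parity : ∀ {k} → HalfView k → f (5 + k) ≡ toℚ (bound (4 + k))
    by-parity (2* j) = trans
      (f-odd (5 + j * 2) (2∤1+j*2 (2 + j)) refl (cong +_ (m*n/n≡m j 2)))
      (cong (λ e → toℚ (2 ^ (4 + j * 2) + e)) (sym (ε-even j)))
    by-parity (1+2* j) = trans
      (f-even (6 + j * 2) (divides (3 + j) refl) refl (cong +_ (m*n/n≡m j 2)))
      (cong (λ e → toℚ (2 ^ (5 + j * 2) + e)) (sym (ε-odd j)))

open ClosedForm

-- Spiders as `K_r ∗ mK₂`, the path `P₆`, and the theorem.

open import Data.Nat.Base using (ℕ; zero; suc; _+_; _*_; _∸_; _/_; _≥_)
open import Data.Nat.Divisibility using (_∣_; divides)
open import Data.Nat.DivMod using (m*n/n≡m)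
open import Data.Nat.Properties
open import Data.Rational.Base as ℚ using (_≤_)
open import Data.Fin.Base using (Fin; zero; suc)
import Data.Fin.Properties as Fin
open import Data.Fin.Permutation using (↔⇒≡)
open import Data.Product.Base using (_×_; _,_; proj₁; proj₂)
open import Data.Sum.Base using (_⊎_; inj₁; inj₂)
open import Data.Unit.Base using (tt)
open import Function.Bundles using (Inverse; mk↔ₛ′; _⇔_; mk⇔)
open import Function.Properties.Inverse using (↔-trans)
open import Relation.Binary.PropositionalEquality using (_≡_; refl; sym; trans; cong; subst; subst₂)
open import Relation.Nullary.Decidable using (yes; no; toWitness; _×-dec_; _→-dec_)
open import Relation.Nullary.Negation using (¬_; contradiction)
open Inverse using (strictlyInverseˡ; strictlyInverseʳ)

-- The next `P₂` is attached at the root on one side and at the distinguished vertex `zero` on the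
-- other, so these must correspond for the induction on `m`.
record CentredIso (t : Tree) (r m : ℕ) : Set where
  field
    iso   : graph t ≅ K[1+ r ]∗ m K₂
    root≡ : _≅_.to iso (root t) ≡ inj₁ zero

leaf-centred : CentredIso leaf 0 0
leaf-centred = record { iso = mk≅ (mk↔ₛ′ (λ _ → inj₁ zero) (λ _ → tt) (λ { (inj₁ zero) → refl }) λ _ → refl)
                                  (λ _ _ ()) (λ { (inj₁ zero) (inj₁ zero) e → contradiction refl e })
                      ; root≡ = refl }

P₂-centred : CentredIso P₂ 1 0
P₂-centred = record
  { iso = mk≅ (mk↔ₛ′ to from to-from from-to)
      (λ { (inj₁ _) (inj₂ _) _ () ; (inj₂ _) (inj₁ _) _ () })
      (λ { (inj₁ zero) (inj₁ zero) e → contradiction refl e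
         ; (inj₁ zero) (inj₁ (suc zero)) _ → refl , refl
         ; (inj₁ (suc zero)) (inj₁ zero) _ → refl , refl
         ; (inj₁ (suc zero)) (inj₁ (suc zero)) e → contradiction refl e })
  ; root≡ = refl }
  where
  to : Vertex P₂ → Fin 2 ⊎ (Fin 0 × Fin 2)
  to (inj₁ _) = inj₁ zero
  to (inj₂ _) = inj₁ (suc zero)
  from : Fin 2 ⊎ (Fin 0 × Fin 2) → Vertex P₂
  from (inj₁ zero)    = inj₁ tt
  from (inj₁ (suc _)) = inj₂ tt
  to-from : ∀ v → to (from v) ≡ v
  to-from (inj₁ zero)       = refl
  to-from (inj₁ (suc zero)) = refl
  from-to : ∀ v → from (to v) ≡ v
  from-to (inj₁ _) = refl
  from-to (inj₂ _) = refl

join-P₂-centred : ∀ {t r m} → CentredIso t r m → CentredIso (join t P₂) r (suc m)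
join-P₂-centred {t} {r} {m} t≅K = record
  { iso = mk≅ (mk↔ₛ′ to′ from′ to-from from-to) to-hom′ from-hom′
  ; root≡ = cong place root≡ }
  where
  open CentredIso t≅K
  open _≅_ iso
  Kᵐ Kᵐ⁺¹ : Set
  Kᵐ   = Fin (suc r) ⊎ (Fin m × Fin 2)
  Kᵐ⁺¹ = Fin (suc r) ⊎ (Fin (suc m) × Fin 2)
  place : Kᵐ → Kᵐ⁺¹
  place (inj₁ i)       = inj₁ i
  place (inj₂ (j , b)) = inj₂ (suc j , b)
  to′ : Vertex (join t P₂) → Kᵐ⁺¹
  to′ (inj₁ v)        = place (to v)
  to′ (inj₂ (inj₁ _)) = inj₂ (zero , zero)
  to′ (inj₂ (inj₂ _)) = inj₂ (zero , suc zero)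
  from′ : Kᵐ⁺¹ → Vertex (join t P₂)
  from′ (inj₁ i)                = inj₁ (from (inj₁ i))
  from′ (inj₂ (zero , zero))    = inj₂ (inj₁ tt)
  from′ (inj₂ (zero , suc _))   = inj₂ (inj₂ tt)
  from′ (inj₂ (suc j , b))      = inj₁ (from (inj₂ (j , b)))
  from-place : ∀ v → from′ (place v) ≡ inj₁ (from v)
  from-place (inj₁ _) = refl
  from-place (inj₂ _) = refl
  from-to : ∀ v → from′ (to′ v) ≡ v
  from-to (inj₁ v)        = trans (from-place (to v)) (cong inj₁ (strictlyInverseʳ bijection v))
  from-to (inj₂ (inj₁ _)) = refl
  from-to (inj₂ (inj₂ _)) = refl
  to-from : ∀ v → to′ (from′ v) ≡ v
  to-from (inj₁ i)                   = cong place (strictlyInverseˡ bijection (inj₁ i))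
  to-from (inj₂ (zero , zero))       = refl
  to-from (inj₂ (zero , suc zero))   = refl
  to-from (inj₂ (suc j , b))         = cong place (strictlyInverseˡ bijection (inj₂ (j , b)))
  from-root : from (inj₁ zero) ≡ root t
  from-root = trans (cong from (sym root≡)) (strictlyInverseʳ bijection (root t))
  place-hom : Hom (K[1+ r ]∗ m K₂) (K[1+ r ]∗ (suc m) K₂) place
  place-hom (inj₁ _) (inj₁ _) e = e
  place-hom (inj₁ _) (inj₂ _) e = e
  place-hom (inj₂ _) (inj₁ _) e = e
  place-hom (inj₂ _) (inj₂ _) (e , e′) = cong suc e , e′
  to-hom′ : Hom (graph (join t P₂)) (K[1+ r ]∗ (suc m) K₂) to′
  to-hom′ (inj₁ v) (inj₁ w) e = place-hom (to v) (to w) (to-hom iso v w e)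
  to-hom′ (inj₁ v) (inj₂ (inj₁ _)) (refl , _) rewrite root≡ = refl , refl
  to-hom′ (inj₁ v) (inj₂ (inj₂ _)) (_ , ())
  to-hom′ (inj₂ (inj₁ _)) (inj₁ w) (refl , _) rewrite root≡ = refl , refl
  to-hom′ (inj₂ (inj₂ _)) (inj₁ w) (_ , ())
  to-hom′ (inj₂ (inj₁ _)) (inj₂ (inj₂ _)) _ = refl , λ ()
  to-hom′ (inj₂ (inj₂ _)) (inj₂ (inj₁ _)) _ = refl , λ ()
  from-hom′ : Hom (K[1+ r ]∗ (suc m) K₂) (graph (join t P₂)) from′
  from-hom′ (inj₁ i) (inj₁ j) e = from-hom iso (inj₁ i) (inj₁ j) e
  from-hom′ (inj₁ i) (inj₂ (zero , zero)) (refl , _) = from-root , refl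
  from-hom′ (inj₁ i) (inj₂ (zero , suc _)) (_ , ())
  from-hom′ (inj₁ i) (inj₂ (suc j , b)) e = from-hom iso (inj₁ i) (inj₂ (j , b)) e
  from-hom′ (inj₂ (zero , zero)) (inj₁ i) (refl , _) = from-root , refl
  from-hom′ (inj₂ (zero , suc _)) (inj₁ i) (_ , ())
  from-hom′ (inj₂ (suc j , b)) (inj₁ i) e = from-hom iso (inj₂ (j , b)) (inj₁ i) e
  from-hom′ (inj₂ (zero , zero)) (inj₂ (zero , zero)) (_ , e) = contradiction refl e
  from-hom′ (inj₂ (zero , zero)) (inj₂ (zero , suc zero)) _ = refl , refl
  from-hom′ (inj₂ (zero , suc zero)) (inj₂ (zero , zero)) _ = refl , refl
  from-hom′ (inj₂ (zero , suc zero)) (inj₂ (zero , suc zero)) (_ , e) = contradiction refl e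
  from-hom′ (inj₂ (zero , _)) (inj₂ (suc _ , _)) (() , _)
  from-hom′ (inj₂ (suc _ , _)) (inj₂ (zero , _)) (() , _)
  from-hom′ (inj₂ (suc i , b)) (inj₂ (suc j , c)) (eq , e) =
    from-hom iso (inj₂ (i , b)) (inj₂ (j , c)) (Fin.suc-injective eq , e)

spider-centred : ∀ {t r} → CentredIso t r 0 → ∀ m → CentredIso (spider t m) r m
spider-centred t≅K zero    = t≅K
spider-centred t≅K (suc m) = join-P₂-centred (spider-centred t≅K m)

spider-leaf≅ : ∀ m → graph (spider leaf m) ≅ K₁∗ m K₂
spider-leaf≅ m = CentredIso.iso (spider-centred leaf-centred m)

spider-P₂≅ : ∀ m → graph (spider P₂ m) ≅ K₂∗ m K₂
spider-P₂≅ m = CentredIso.iso (spider-centred P₂-centred m)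

P₆ : Tree
P₆ = join P₄ P₂
  where P₄ = join leaf P₃

-- The numbering starts at the far end of the pendant `P₂` and reaches the root third. Both
-- adjacency relations are decidable, so all pairs in `Fin 6` are checked by evaluation.
P₆≅path : graph P₆ ≅ path 6
P₆≅path = mk≅ (mk↔ₛ′ to from to-from from-to)
  (λ v w e → proj₂ (hom (to v) (to w)) (subst₂ (Graph._~_ (graph P₆)) (sym (from-to v)) (sym (from-to w)) e))
  (λ i j → proj₁ (hom i j))
  where
  to : Vertex P₆ → Fin 6
  to (inj₂ (inj₂ _))               = zero
  to (inj₂ (inj₁ _))               = suc zero
  to (inj₁ (inj₁ _))               = suc (suc zero)
  to (inj₁ (inj₂ (inj₁ _)))        = suc (suc (suc zero))
  to (inj₁ (inj₂ (inj₂ (inj₁ _)))) = suc (suc (suc (suc zero)))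
  to (inj₁ (inj₂ (inj₂ (inj₂ _)))) = suc (suc (suc (suc (suc zero))))
  from : Fin 6 → Vertex P₆
  from zero                               = inj₂ (inj₂ tt)
  from (suc zero)                         = inj₂ (inj₁ tt)
  from (suc (suc zero))                   = inj₁ (inj₁ tt)
  from (suc (suc (suc zero)))             = inj₁ (inj₂ (inj₁ tt))
  from (suc (suc (suc (suc zero))))       = inj₁ (inj₂ (inj₂ (inj₁ tt)))
  from (suc (suc (suc (suc (suc zero))))) = inj₁ (inj₂ (inj₂ (inj₂ tt)))
  to-from : ∀ i → to (from i) ≡ i
  to-from = toWitness {a? = Fin.all? λ i → to (from i) Fin.≟ i} tt
  from-to : ∀ v → from (to v) ≡ v
  from-to (inj₂ (inj₂ _))               = refl
  from-to (inj₂ (inj₁ _))               = refl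
  from-to (inj₁ (inj₁ _))               = refl
  from-to (inj₁ (inj₂ (inj₁ _)))        = refl
  from-to (inj₁ (inj₂ (inj₂ (inj₁ _)))) = refl
  from-to (inj₁ (inj₂ (inj₂ (inj₂ _)))) = refl
  open Graph (graph P₆) using () renaming (_~_ to _~ᵗ_; _~?_ to _~ᵗ?_)
  open Graph (path 6) using () renaming (_~_ to _~ᵖ_; _~?_ to _~ᵖ?_)
  hom : ∀ i j → (i ~ᵖ j → from i ~ᵗ from j) × (from i ~ᵗ from j → i ~ᵖ j)
  hom = toWitness {a? = Fin.all? λ i → Fin.all? λ j →
    ((i ~ᵖ? j) →-dec (from i ~ᵗ? from j)) ×-dec ((from i ~ᵗ? from j) →-dec (i ~ᵖ? j))} tt

order≡ : ∀ {n} {G : Graph (Fin n)} t → G ≅ graph t → n ≡ suc (edges t)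
order≡ t G≅t = ↔⇒≡ (↔-trans (_≅_.bijection G≅t) (Vertex↔Fin t))

edges-spider : ∀ t m → edges (spider t m) ≡ m * 2 + edges t
edges-spider t zero    = refl
edges-spider t (suc m) = trans (cong suc (+-comm (edges (spider t m)) 1)) (cong (2 +_) (edges-spider t m))

module _ {n : ℕ} {T : Graph (Fin n)} where
  order-spider : ∀ t m → T ≅ graph (spider t m) → n ≡ suc (m * 2 + edges t)
  order-spider t m T≅ = trans (order≡ (spider t m) T≅) (cong suc (edges-spider t m))

  odd-spider⇒≅F : ∀ m → T ≅ graph (spider leaf m) → T ≅F n
  odd-spider⇒≅F m T≅ = odd (subst (λ n → ¬ 2 ∣ n) (sym n≡) (2∤1+j*2 m))
    (subst (λ i → T ≅ K₁∗ i K₂) (sym m≡) (≅-trans T≅ (spider-leaf≅ m)))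
    where
    n≡ : n ≡ 1 + m * 2
    n≡ = trans (order-spider leaf m T≅) (cong suc (+-identityʳ (m * 2)))
    m≡ : (n ∸ 1) / 2 ≡ m
    m≡ = trans (cong (λ n → (n ∸ 1) / 2) n≡) (m*n/n≡m m 2)

  even-spider⇒≅F : ∀ m → T ≅ graph (spider P₂ m) → T ≅F n
  -- The order is 2 + 2m, so m = 2 is exactly the order 6, which has its own constructor.
  even-spider⇒≅F m T≅ with m ≟ 2
  ... | yes refl = six-star (order-spider P₂ 2 T≅) (≅-trans T≅ (spider-P₂≅ 2))
  ... | no  m≢2  = even (divides (suc m) n≡)
    (λ n≡6 → m≢2 (*-cancelʳ-≡ m 2 2 (suc-injective (suc-injective (trans (sym n≡) n≡6)))))
    (subst (λ i → T ≅ K₂∗ i K₂) (sym m≡) (≅-trans T≅ (spider-P₂≅ m)))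
    where
    n≡ : n ≡ 2 + m * 2
    n≡ = trans (order-spider P₂ m T≅) (cong suc (+-comm (m * 2) 1))
    m≡ : (n ∸ 2) / 2 ≡ m
    m≡ = trans (cong (λ n → (n ∸ 2) / 2) n≡) (m*n/n≡m m 2)

  Extremal⇒≅F : ∀ {t} → T ≅ graph t → Extremal t → T ≅F n
  Extremal⇒≅F T≅t (odd-spider m t≈)  = odd-spider⇒≅F m (≅-trans T≅t (_≈_.iso t≈))
  Extremal⇒≅F T≅t (even-spider m t≈) = even-spider⇒≅F m (≅-trans T≅t (_≈_.iso t≈))
  Extremal⇒≅F T≅t (six-path t≈)      = six-path (order≡ P₆ T≅P₆) (≅-trans T≅P₆ P₆≅path)
    where T≅P₆ = ≅-trans T≅t (_≈_.iso t≈)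

  -- The isomorphism alone determines `n` as `suc (edges t)`, which turns `f n` into
  -- `bound (edges t)`.
  d≡f : ∀ t → T ≅ graph t → σ t ≡ bound (edges t) → toℚ (d T) ≡ f n
  d≡f t T≅t σ≡ = trans (cong toℚ (trans (d≡σ T t T≅t) σ≡))
    (trans (sym (f≡bound (edges t))) (cong f (sym (order≡ t T≅t))))

  K₁∗⇒d≡f : ∀ m → T ≅ K₁∗ m K₂ → toℚ (d T) ≡ f n
  K₁∗⇒d≡f m T≅ = d≡f (spider leaf m) (≅-trans T≅ (≅-sym (spider-leaf≅ m)))
    (proj₂ (proj₂ (spider-tight leaf leaf-tight m)))

  K₂∗⇒d≡f : ∀ m → T ≅ K₂∗ m K₂ → toℚ (d T) ≡ f n
  K₂∗⇒d≡f m T≅ = d≡f (spider P₂ m) (≅-trans T≅ (≅-sym (spider-P₂≅ m)))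
    (proj₂ (proj₂ (spider-tight P₂ P₂-tight m)))

  ≅F⇒d≡f : T ≅F n → toℚ (d T) ≡ f n
  ≅F⇒d≡f (odd _ T≅)      = K₁∗⇒d≡f _ T≅
  ≅F⇒d≡f (six-path _ T≅) = d≡f P₆ (≅-trans T≅ (≅-sym P₆≅path)) refl
  ≅F⇒d≡f (six-star _ T≅) = K₂∗⇒d≡f 2 T≅
  ≅F⇒d≡f (even _ _ T≅)   = K₂∗⇒d≡f _ T≅

theorem3p1 : ∀ (n : ℕ) → n ≥ 1 → (T : Graph (Fin n)) → IsTree T →
    toℚ (d T) ≤ f n × (toℚ (d T) ≡ f n ⇔ T ≅F n)
theorem3p1 (suc k) _ T isTree =
  subst₂ _≤_ (cong toℚ (sym d≡)) (sym f≡) (toℚ-mono-≤ (proj₁ (optimal t))) ,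
  mk⇔ (λ eq → Extremal⇒≅F T≅t (proj₂ (optimal t) (toℚ-injective (trans (cong toℚ (sym d≡)) (trans eq f≡))))) ≅F⇒d≡f
  where
  t   = proj₁ (tree-representation isTree)
  T≅t = proj₂ (tree-representation isTree)
  d≡ : d T ≡ σ t
  d≡ = d≡σ T t T≅t
  f≡ : f (suc k) ≡ toℚ (bound (edges t))
  f≡ = trans (cong f (order≡ t T≅t)) (f≡bound (edges t))
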